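{- Let $n\ge 17$. For each integer $a$ with $3\le a\le \lfloor (n+3)/5\rfloor$ and $n-a\equiv 1\pmod 2$, every integer in the interval $\left[\binom{a-1}{2}+1,\ \binom{a}{2}\right]$ is an eigenvalue of $\mathrm{Cay}(S_n,T_n)$.
   Context: $\mathrm{Cay}(S_n,T_n)$ is the Cayley graph with vertex set the symmetric group $S_n$, where $f,g$ are adjacent iff $fg^{ -1}$ is a transposition; its eigenvalues are those of its adjacency matrix. -}

module Defs where

open import Data.Nat using (ℕ; _<_; _<ᵇ_)
open import Data.Bool using (if_then_else_)
open import Data.Fin using (Fin; toℕ)
open import Data.List using (List; map; foldr; allFin)
open import Data.Vec using (Vec; lookup)
import Data.Vec as Vec
open import Data.Integer using (ℤ; _+_; _*_; 0ℤ; +_)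
open import Data.Product using (Σ; ∃; _×_)
open import Relation.Binary.PropositionalEquality using (_≡_; _≢_)
open import Data.Fin.Permutation.Components using (transpose)

Σℤ : ∀ {n} → (Fin n → ℤ) → ℤ
Σℤ {n} f = foldr _+_ 0ℤ (map f (allFin n))

-- Elements of S_n are represented by their value tables f = (f(0),…,f(n-1)),
-- i.e. injective vectors (an injective map Fin n → Fin n is a bijection).
IsPerm : ∀ {n} → Vec (Fin n) n → Set
IsPerm {n} f = ∀ (i j : Fin n) → lookup f i ≡ lookup f j → i ≡ j

tmul : ∀ {n} → Fin n → Fin n → Vec (Fin n) n → Vec (Fin n) n
tmul i j f = Vec.map (transpose i j) f

-- Adjacency operator of Cay(S_n, T_n) applied to a vector v : S_n → ℤ.
-- g ~ f iff f g⁻¹ = t ∈ T_n iff g = t f; T_n = {(i j) : i < j}.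
adj : ∀ {n} → (Vec (Fin n) n → ℤ) → Vec (Fin n) n → ℤ
adj {n} v f =
  Σℤ (λ i → Σℤ (λ j → if toℕ i <ᵇ toℕ j then v (tmul i j f) else 0ℤ))

IsCayTEigenvalue : ℕ → ℤ → Set
IsCayTEigenvalue n λ′ =
  Σ (Vec (Fin n) n → ℤ) λ v →
    (∀ f → IsPerm f → adj v f ≡ λ′ * v f) ×
    (∃ λ g → IsPerm g × v g ≢ 0ℤ)

{-# OPTIONS --safe #-}
module Submission where

-- Content sums of partitions are eigenvalues of Cay(S_n, T_n), and the corollary only needs suitable partitions.
-- Eigenvectors are built row by row, each new row on top and at least as long as the rows below it: if χ on S_m
-- is an eigenvector that changes sign when two entries of one column are exchanged, then on S_(m+k)
--   f ↦ Σ_σ χ(σ) ∏_l ([f(l) = σ(l)] − [f(new cell of the column of l) = σ(l)])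
-- is again column-antisymmetric, and it is an eigenvector whose eigenvalue has grown by C(k,2) − m, which is
-- exactly how the content sum grows.  For k = C(a,2) − j with a = j + 2 + d, the partition
-- (a + 1 + e, a + 1, j + 2, 2^(j−1), 1^(d+e+1)) of n = 3a + 2j + 1 + 2e (no middle rows when j = 0) has content
-- sum k, and n − a odd with 5a ≤ n + 3 is exactly what makes some e ≥ 0 fit.

open import Defs

module PartitionEigenvalues where

  import Algebra.Properties.CommutativeMonoid.Sum as MonoidSum
  import Algebra.Properties.Semiring.Sum as SemiringSum
  open import Data.Bool using (true; false; if_then_else_)
  open import Data.Empty using (⊥; ⊥-elim)
  open import Data.Fin as Fin using (Fin; zero; suc; toℕ; _↑ˡ_; _↑ʳ_)
  open import Data.Fin.Properties as FinP using (_≟_)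
  import Data.Fin.Permutation as Perm
  open import Data.Fin.Permutation.Components using (transpose; transpose-inverse)
  open import Data.Integer using (ℤ; 0ℤ; 1ℤ; +_; _+_; _*_; -_; _-_)
  import Data.Integer.Properties as ℤP
  open import Algebra.Properties.AbelianGroup ℤP.+-0-abelianGroup using (∙-cancelʳ)
  open import Data.Integer.Tactic.RingSolver using (solve-∀)
  import Data.Nat.Tactic.RingSolver as ℕSolver
  open import Data.List as List using (List; []; _∷_; tabulate)
  import Data.List.Properties as ListP
  open import Data.List.Relation.Unary.Linked using (Linked; []; [-]; _∷_)
  open import Data.Nat as ℕ using (ℕ; zero; suc)
  import Data.Nat.Properties as ℕP
  open import Data.Nat.DivMod using (_/_; _%_; m≡m%n+[m/n]*n; m/n*n≤m)
  open import Data.Nat.Combinatorics using (_C_; nC1≡n; nCk+nC[k+1]≡[n+1]C[k+1])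
  open import Data.Vec as Vec using (Vec; []; _∷_; lookup)
  import Data.Vec.Properties as VecP
  open import Data.Product using (∃; _×_; _,_; proj₁; proj₂)
  open import Data.Sum using ([_,_]′)
  open import Function using (_∘_)
  open import Relation.Binary.PropositionalEquality
  open import Relation.Nullary using (Dec; yes; no; does; ¬_)
  open import Relation.Nullary.Decidable using (dec-true; dec-false; _→-dec_)

  private
    variable
      m n : ℕ

  open SemiringSum ℤP.+-*-semiring
    using (sum; sum-cong-≗; ∑-distrib-+; ∑-comm; *-distribˡ-sum; *-distribʳ-sum)

  module Product = MonoidSum ℤP.*-1-commutativeMonoid

  product : (Fin n → ℤ) → ℤ
  product = Product.sum

  Σℤ≡sum : (f : Fin n → ℤ) → Σℤ f ≡ sum f
  Σℤ≡sum f = trans (cong (List.foldr _+_ 0ℤ) (ListP.map-tabulate (λ i → i) f)) (foldr-tabulate f)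
    where
    foldr-tabulate : ∀ {n} (f : Fin n → ℤ) → List.foldr _+_ 0ℤ (tabulate f) ≡ sum f
    foldr-tabulate {zero} f = refl
    foldr-tabulate {suc n} f = cong (_+_ (f zero)) (foldr-tabulate (f ∘ suc))

  sum-zero : {f : Fin n → ℤ} → (∀ i → f i ≡ 0ℤ) → sum f ≡ 0ℤ
  sum-zero {zero} f≡0 = refl
  sum-zero {suc n} f≡0 = cong₂ _+_ (f≡0 zero) (sum-zero (f≡0 ∘ suc))

  sum-const : ∀ n (c : ℤ) → sum {n} (λ _ → c) ≡ + n * c
  sum-const zero c = refl
  sum-const (suc n) c = trans (cong (_+_ c) (sum-const n c)) (ring c (+ n))
    where
    ring : ∀ c x → c + x * c ≡ (1ℤ + x) * c
    ring = solve-∀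

  sum-neg : (f : Fin n → ℤ) → sum (λ i → - f i) ≡ - sum f
  sum-neg f = trans (sum-cong-≗ (λ i → sym (ℤP.-1*i≡-i (f i)))) (trans (sym (*-distribˡ-sum (- 1ℤ) f)) (ℤP.-1*i≡-i (sum f)))

  sum-↑ : ∀ {m k} (f : Fin (m ℕ.+ k) → ℤ) → sum f ≡ sum (λ i → f (i ↑ˡ k)) + sum (λ c → f (m ↑ʳ c))
  sum-↑ {zero} f = sym (ℤP.+-identityˡ _)
  sum-↑ {suc m} {k} f = trans (cong (_+_ (f zero)) (sum-↑ {m} {k} (f ∘ suc))) (sym (ℤP.+-assoc (f zero) _ _))

  sum-transpose : (i j : Fin n) (f : Fin n → ℤ) → sum (f ∘ transpose i j) ≡ sum f
  sum-transpose i j f = sym (SemiringSum.sum-permute ℤP.+-*-semiring f (Perm.transpose i j))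

  product-transpose : (i j : Fin n) (f : Fin n → ℤ) → product (f ∘ transpose i j) ≡ product f
  product-transpose i j f = sym (Product.sum-permute f (Perm.transpose i j))

  δ : Fin n → Fin n → ℤ
  δ x y = if does (x ≟ y) then 1ℤ else 0ℤ

  δ-refl : (x : Fin n) → δ x x ≡ 1ℤ
  δ-refl x rewrite dec-true (x ≟ x) refl = refl

  δ-≢ : {x y : Fin n} → x ≢ y → δ x y ≡ 0ℤ
  δ-≢ {x = x} {y} x≢y rewrite dec-false (x ≟ y) x≢y = refl

  δ-sym : (x y : Fin n) → δ x y ≡ δ y x
  δ-sym x y with x ≟ y
  ... | yes refl = sym (δ-refl x)
  ... | no x≢y = sym (δ-≢ (x≢y ∘ sym))

  sum-δ : (x : Fin n) (F : Fin n → ℤ) → sum (λ y → δ x y * F y) ≡ F x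
  sum-δ {suc n} zero F =
    trans (cong₂ _+_ (ℤP.*-identityˡ (F zero)) (sum-zero (λ y → ℤP.*-zeroˡ (F (suc y))))) (ℤP.+-identityʳ (F zero))
  sum-δ {suc n} (suc x) F = trans (cong₂ _+_ (ℤP.*-zeroˡ (F zero)) (sum-δ x (F ∘ suc))) (ℤP.+-identityˡ (F (suc x)))

  sum-δ₁ : (x : Fin n) → sum (δ x) ≡ 1ℤ
  sum-δ₁ x = trans (sum-cong-≗ (λ y → sym (ℤP.*-identityʳ (δ x y)))) (sum-δ x (λ _ → 1ℤ))

  sum-δ₂ : (x y : Fin n) (g : ℤ) → sum (λ a → sum (λ b → δ x a * (δ y b * g))) ≡ g
  sum-δ₂ x y g = trans (sum-cong-≗ λ a → trans (sym (*-distribˡ-sum (δ x a) (λ b → δ y b * g))) (cong (δ x a *_) (sum-δ y (λ _ → g))))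
                       (sum-δ x (λ _ → g))

  δ*δ≡0 : {x y : Fin n} → x ≢ y → ∀ u → δ x u * δ y u ≡ 0ℤ
  δ*δ≡0 {x = x} {y} x≢y u with x ≟ u
  ... | yes refl = cong (1ℤ *_) (δ-≢ (x≢y ∘ sym))
  ... | no _ = ℤP.*-zeroˡ (δ y u)

  transpose-matchˡ : (i j : Fin n) → transpose i j i ≡ j
  transpose-matchˡ i j rewrite dec-true (i ≟ i) refl = refl

  transpose-matchʳ : (i j : Fin n) → transpose i j j ≡ i
  transpose-matchʳ i j with j ≟ i
  ... | yes refl = refl
  ... | no _ rewrite dec-true (j ≟ j) refl = refl

  transpose-mismatch : {i j k : Fin n} → k ≢ i → k ≢ j → transpose i j k ≡ k
  transpose-mismatch {i = i} {j} {k} k≢i k≢j rewrite dec-false (k ≟ i) k≢i | dec-false (k ≟ j) k≢j = refl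

  transpose-comm : (i j k : Fin n) → transpose i j k ≡ transpose j i k
  transpose-comm i j k = by-cases (k ≟ i) (k ≟ j)
    where
    by-cases : Dec (k ≡ i) → Dec (k ≡ j) → transpose i j k ≡ transpose j i k
    by-cases (yes refl) _ = trans (transpose-matchˡ k j) (sym (transpose-matchʳ j k))
    by-cases (no _) (yes refl) = trans (transpose-matchʳ i k) (sym (transpose-matchˡ k i))
    by-cases (no k≢i) (no k≢j) = trans (transpose-mismatch k≢i k≢j) (sym (transpose-mismatch k≢j k≢i))

  transpose-involutive : (i j k : Fin n) → transpose i j (transpose i j k) ≡ k
  transpose-involutive i j k = trans (cong (transpose i j) (transpose-comm i j k)) (transpose-inverse i j)

  δ-transpose : (a b x y : Fin n) → δ (transpose a b x) y ≡ δ x (transpose a b y)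
  δ-transpose a b x y = by-cases (x ≟ transpose a b y)
    where
    by-cases : Dec (x ≡ transpose a b y) → δ (transpose a b x) y ≡ δ x (transpose a b y)
    by-cases (yes x≡) = trans (δ-refl′ (trans (cong (transpose a b) x≡) (transpose-involutive a b y))) (sym (δ-refl′ x≡))
      where
      δ-refl′ : ∀ {u v : Fin _} → u ≡ v → δ u v ≡ 1ℤ
      δ-refl′ {u} refl = δ-refl u
    by-cases (no x≢) =
      trans (δ-≢ {x = transpose a b x} (λ e → x≢ (trans (sym (transpose-involutive a b x)) (cong (transpose a b) e))))
            (sym (δ-≢ x≢))

  _except_ : (Fin n → ℤ) → Fin n → Fin n → ℤ
  (F except i) l = if does (l ≟ i) then 1ℤ else F l

  product-pick : (F : Fin n → ℤ) (i : Fin n) → product F ≡ F i * product (F except i)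
  product-pick F zero = cong (F zero *_) (sym (ℤP.*-identityˡ (product (F ∘ suc))))
  product-pick F (suc i) = trans (cong (F zero *_) (product-pick (F ∘ suc) i)) (ring (F zero) (F (suc i)) (product ((F ∘ suc) except i)))
    where
    ring : ∀ a b c → a * (b * c) ≡ b * (a * c)
    ring = solve-∀

  product-zero : (F : Fin n → ℤ) (i : Fin n) → F i ≡ 0ℤ → product F ≡ 0ℤ
  product-zero F i Fi≡0 = trans (product-pick F i) (trans (cong (_* product (F except i)) Fi≡0) (ℤP.*-zeroˡ (product (F except i))))

  except-≢ : (F : Fin n → ℤ) {i l : Fin n} → l ≢ i → (F except i) l ≡ F l
  except-≢ F {i} {l} l≢i rewrite dec-false (l ≟ i) l≢i = refl

  except-cong : {F G : Fin n → ℤ} (i : Fin n) → (∀ l → l ≢ i → F l ≡ G l) → ∀ l → (F except i) l ≡ (G except i) l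
  except-cong i F≡G l with l ≟ i
  ... | yes _ = refl
  ... | no l≢i = F≡G l l≢i

  sum-split-at : (i : Fin n) (F : Fin n → ℤ) → sum F ≡ F i + sum (λ j → (1ℤ - δ i j) * F j)
  sum-split-at i F = begin
    sum F                                                      ≡⟨ sum-cong-≗ (λ j → ring (δ i j) (F j)) ⟩
    sum (λ j → δ i j * F j + (1ℤ - δ i j) * F j)               ≡⟨ ∑-distrib-+ (λ j → δ i j * F j) _ ⟩
    sum (λ j → δ i j * F j) + sum (λ j → (1ℤ - δ i j) * F j)   ≡⟨ cong (_+ sum (λ j → (1ℤ - δ i j) * F j)) (sum-δ i F) ⟩
    F i + sum (λ j → (1ℤ - δ i j) * F j)                       ∎
    where
    open ≡-Reasoning
    ring : ∀ d x → x ≡ d * x + (1ℤ - d) * x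
    ring = solve-∀

  does-≟-injective : ∀ {A : Set} {g : Fin n → Fin m} → (∀ i j → g i ≡ g j → i ≡ j) → ∀ l i (x y : A) →
                     (if does (g l ≟ g i) then x else y) ≡ (if does (l ≟ i) then x else y)
  does-≟-injective {g = g} g-inj l i x y with l ≟ i
  ... | yes refl rewrite dec-true (g l ≟ g l) refl = refl
  ... | no l≢i rewrite dec-false (g l ≟ g i) (l≢i ∘ g-inj l i) = refl

  <ᵇ-irrefl : ∀ n → (n ℕ.<ᵇ n) ≡ false
  <ᵇ-irrefl zero = refl
  <ᵇ-irrefl (suc n) = <ᵇ-irrefl n

  hybrid : (A B : Fin n → ℤ) → Fin n → Fin n → ℤ
  hybrid A B l l′ = if toℕ l′ ℕ.<ᵇ toℕ l then A l′ else (if does (l′ ≟ l) then A l′ - B l′ else B l′)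

  product-telescope : (A B : Fin n → ℤ) → product A ≡ product B + sum (λ l → product (hybrid A B l))
  product-telescope {zero} A B = refl
  product-telescope {suc n} A B = begin
    A zero * product (A ∘ suc)
      ≡⟨ cong (A zero *_) (product-telescope (A ∘ suc) (B ∘ suc)) ⟩
    A zero * (product (B ∘ suc) + sum tail)
      ≡⟨ ring (A zero) (B zero) (product (B ∘ suc)) (sum tail) ⟩
    B zero * product (B ∘ suc) + ((A zero - B zero) * product (B ∘ suc) + A zero * sum tail)
      ≡⟨ cong (λ s → B zero * product (B ∘ suc) + ((A zero - B zero) * product (B ∘ suc) + s)) (*-distribˡ-sum (A zero) tail) ⟩
    B zero * product (B ∘ suc) + ((A zero - B zero) * product (B ∘ suc) + sum (λ l → A zero * tail l)) ∎
    where
    open ≡-Reasoning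
    tail : Fin n → ℤ
    tail l = product (hybrid (A ∘ suc) (B ∘ suc) l)
    ring : ∀ a b p s → a * (p + s) ≡ b * p + ((a - b) * p + a * s)
    ring = solve-∀

  vec-ext : ∀ {A : Set} {u w : Vec A n} → (∀ p → lookup u p ≡ lookup w p) → u ≡ w
  vec-ext {u = u} {w} u≗w = trans (sym (VecP.tabulate∘lookup u)) (trans (VecP.tabulate-cong u≗w) (VecP.tabulate∘lookup w))

  swapAt : ∀ {A : Set} → Fin n → Fin n → Vec A n → Vec A n
  swapAt i j σ = Vec.tabulate (lookup σ ∘ transpose i j)

  lookup-swapAt : ∀ {A : Set} (i j : Fin n) (σ : Vec A n) (p : Fin n) → lookup (swapAt i j σ) p ≡ lookup σ (transpose i j p)
  lookup-swapAt i j σ p = VecP.lookup∘tabulate _ p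

  swapAt-involutive : ∀ {A : Set} (i j : Fin n) (σ : Vec A n) → swapAt i j (swapAt i j σ) ≡ σ
  swapAt-involutive i j σ = vec-ext λ p → trans (lookup-swapAt i j (swapAt i j σ) p)
    (trans (lookup-swapAt i j σ (transpose i j p)) (cong (lookup σ) (transpose-involutive i j p)))

  swapAt-comm : ∀ {A : Set} (i j : Fin n) (σ : Vec A n) → swapAt i j σ ≡ swapAt j i σ
  swapAt-comm i j σ = VecP.tabulate-cong (λ p → cong (lookup σ) (transpose-comm i j p))

  lookup-tmul : (a b : Fin n) (σ : Vec (Fin n) n) (p : Fin n) → lookup (tmul a b σ) p ≡ transpose a b (lookup σ p)
  lookup-tmul a b σ p = VecP.lookup-map p _ σ

  tmul-involutive : (a b : Fin n) (σ : Vec (Fin n) n) → tmul a b (tmul a b σ) ≡ σ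
  tmul-involutive a b σ = vec-ext λ p →
    trans (lookup-tmul a b (tmul a b σ) p) (trans (cong (transpose a b) (lookup-tmul a b σ p)) (transpose-involutive a b (lookup σ p)))

  idPerm : Vec (Fin n) n
  idPerm {n} = Vec.allFin n

  isPerm? : (σ : Vec (Fin n) n) → Dec (IsPerm σ)
  isPerm? σ = FinP.all? λ i → FinP.all? λ j → (lookup σ i ≟ lookup σ j) →-dec (i ≟ j)

  IsPerm-idPerm : IsPerm (idPerm {n})
  IsPerm-idPerm i j e = trans (sym (VecP.lookup-allFin i)) (trans e (VecP.lookup-allFin j))

  IsPerm-tmul : (a b : Fin n) (σ : Vec (Fin n) n) → IsPerm σ → IsPerm (tmul a b σ)
  IsPerm-tmul a b σ σ-inj i j e = σ-inj i j (trans (sym (transpose-involutive a b _)) (trans (cong (transpose a b)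
    (trans (sym (lookup-tmul a b σ i)) (trans e (lookup-tmul a b σ j)))) (transpose-involutive a b _)))

  IsPerm-tmul⁻ : (a b : Fin n) (σ : Vec (Fin n) n) → IsPerm (tmul a b σ) → IsPerm σ
  IsPerm-tmul⁻ a b σ inj i j e = inj i j (trans (lookup-tmul a b σ i) (trans (cong (transpose a b) e) (sym (lookup-tmul a b σ j))))

  IsPerm-swapAt : (a b : Fin n) (σ : Vec (Fin n) n) → IsPerm σ → IsPerm (swapAt a b σ)
  IsPerm-swapAt a b σ σ-inj i j e = trans (sym (transpose-involutive a b i)) (trans (cong (transpose a b)
    (σ-inj _ _ (trans (sym (lookup-swapAt a b σ i)) (trans e (lookup-swapAt a b σ j))))) (transpose-involutive a b j))

  IsPerm-swapAt⁻ : (a b : Fin n) (σ : Vec (Fin n) n) → IsPerm (swapAt a b σ) → IsPerm σ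
  IsPerm-swapAt⁻ a b σ inj = subst IsPerm (swapAt-involutive a b σ) (IsPerm-swapAt a b (swapAt a b σ) inj)

  -- A non-surjective injection Fin n → Fin n would punch out to an injection Fin n → Fin (n - 1).
  lookup-surjective : (σ : Vec (Fin n) n) → IsPerm σ → ∀ u → ∃ λ i → lookup σ i ≡ u
  lookup-surjective σ σ-inj u with FinP.any? (λ i → lookup σ i ≟ u)
  ... | yes hit = hit
  ... | no miss = ⊥-elim (no-injection-missing (lookup σ) σ-inj u (λ i e → miss (i , e)))
    where
    no-injection-missing : ∀ {n} (g : Fin n → Fin n) → (∀ i j → g i ≡ g j → i ≡ j) → (u : Fin n) → (∀ i → g i ≢ u) → ⊥
    no-injection-missing {suc n} g g-inj u missed = ℕP.1+n≰n (FinP.injective⇒≤ {f = λ i → Fin.punchOut (missed i ∘ sym)}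
      (λ {i} {j} e → g-inj i j (FinP.punchOut-injective (missed i ∘ sym) (missed j ∘ sym) e)))

  sum-lookup : (σ : Vec (Fin n) n) → IsPerm σ → (F : Fin n → ℤ) → sum (F ∘ lookup σ) ≡ sum F
  sum-lookup σ σ-inj F = sym (SemiringSum.sum-permute ℤP.+-*-semiring F
    (Perm.permutation (lookup σ) (proj₁ ∘ lookup-surjective σ σ-inj) (proj₂ ∘ lookup-surjective σ σ-inj)
      (λ i → σ-inj _ _ (proj₂ (lookup-surjective σ σ-inj (lookup σ i))))))

  swapAt≡tmul : (σ : Vec (Fin n) n) → IsPerm σ → (i j : Fin n) → swapAt i j σ ≡ tmul (lookup σ i) (lookup σ j) σ
  swapAt≡tmul σ σ-inj i j = vec-ext λ p → trans (lookup-swapAt i j σ p) (trans (at p (p ≟ i) (p ≟ j)) (sym (lookup-tmul _ _ σ p)))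
    where
    at : ∀ p → Dec (p ≡ i) → Dec (p ≡ j) → lookup σ (transpose i j p) ≡ transpose (lookup σ i) (lookup σ j) (lookup σ p)
    at p (yes refl) _ = trans (cong (lookup σ) (transpose-matchˡ p j)) (sym (transpose-matchˡ (lookup σ p) (lookup σ j)))
    at p (no _) (yes refl) = trans (cong (lookup σ) (transpose-matchʳ i p)) (sym (transpose-matchʳ (lookup σ i) (lookup σ p)))
    at p (no p≢i) (no p≢j) = trans (cong (lookup σ) (transpose-mismatch p≢i p≢j))
      (sym (transpose-mismatch (p≢i ∘ σ-inj p i) (p≢j ∘ σ-inj p j)))

  sumWords : ∀ len → (Vec (Fin m) len → ℤ) → ℤ
  sumWords zero h = h []
  sumWords (suc len) h = sum λ a → sumWords len (λ σ → h (a ∷ σ))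

  module _ {m : ℕ} where

    sumWords-cong : ∀ len {g h : Vec (Fin m) len → ℤ} → (∀ σ → g σ ≡ h σ) → sumWords len g ≡ sumWords len h
    sumWords-cong zero g≗h = g≗h []
    sumWords-cong (suc len) g≗h = sum-cong-≗ λ a → sumWords-cong len (g≗h ∘ (a ∷_))

    sumWords-distrib-+ : ∀ len (g h : Vec (Fin m) len → ℤ) → sumWords len (λ σ → g σ + h σ) ≡ sumWords len g + sumWords len h
    sumWords-distrib-+ zero g h = refl
    sumWords-distrib-+ (suc len) g h = trans (sum-cong-≗ λ a → sumWords-distrib-+ len (g ∘ (a ∷_)) (h ∘ (a ∷_)))
      (∑-distrib-+ (λ a → sumWords len (g ∘ (a ∷_))) (λ a → sumWords len (h ∘ (a ∷_))))

    sumWords-distribˡ-* : ∀ len (c : ℤ) (h : Vec (Fin m) len → ℤ) → sumWords len (λ σ → c * h σ) ≡ c * sumWords len h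
    sumWords-distribˡ-* zero c h = refl
    sumWords-distribˡ-* (suc len) c h = trans (sum-cong-≗ λ a → sumWords-distribˡ-* len c (h ∘ (a ∷_)))
      (sym (*-distribˡ-sum c (λ a → sumWords len (h ∘ (a ∷_)))))

    sumWords-neg : ∀ len (h : Vec (Fin m) len → ℤ) → sumWords len (λ σ → - h σ) ≡ - sumWords len h
    sumWords-neg len h = trans (sumWords-cong len (λ σ → sym (ℤP.-1*i≡-i (h σ))))
      (trans (sumWords-distribˡ-* len (- 1ℤ) h) (ℤP.-1*i≡-i (sumWords len h)))

    sumWords-zero : ∀ len {h : Vec (Fin m) len → ℤ} → (∀ σ → h σ ≡ 0ℤ) → sumWords len h ≡ 0ℤ
    sumWords-zero zero h≡0 = h≡0 []
    sumWords-zero (suc len) h≡0 = sum-zero λ a → sumWords-zero len (h≡0 ∘ (a ∷_))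

    sumWords-sum : ∀ len {k} (F : Vec (Fin m) len → Fin k → ℤ) →
                   sumWords len (λ σ → sum (F σ)) ≡ sum (λ i → sumWords len (λ σ → F σ i))
    sumWords-sum zero F = refl
    sumWords-sum (suc len) F = trans (sum-cong-≗ λ a → sumWords-sum len (F ∘ (a ∷_)))
      (∑-comm (λ a i → sumWords len (λ σ → F (a ∷ σ) i)))

    sumWords-sum₂ : ∀ len {k k′} (F : Vec (Fin m) len → Fin k → Fin k′ → ℤ) →
                    sumWords len (λ σ → sum λ a → sum (F σ a)) ≡ sum (λ a → sum λ b → sumWords len (λ σ → F σ a b))
    sumWords-sum₂ len F = trans (sumWords-sum len (λ σ a → sum (F σ a))) (sum-cong-≗ λ a → sumWords-sum len (λ σ → F σ a))

    sumWords-map-transpose : ∀ len (a b : Fin m) (h : Vec (Fin m) len → ℤ) →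
                             sumWords len (h ∘ Vec.map (transpose a b)) ≡ sumWords len h
    sumWords-map-transpose zero a b h = refl
    sumWords-map-transpose (suc len) a b h =
      trans (sum-cong-≗ λ c → sumWords-map-transpose len a b (h ∘ (transpose a b c ∷_)))
            (sum-transpose a b (λ c → sumWords len (h ∘ (c ∷_))))

    sumWords-δ : ∀ len (τ : Vec (Fin m) len) (h : Vec (Fin m) len → ℤ) →
                 sumWords len (λ σ → product (λ l → δ (lookup τ l) (lookup σ l)) * h σ) ≡ h τ
    sumWords-δ zero [] h = ℤP.*-identityˡ (h [])
    sumWords-δ (suc len) (t ∷ τ) h = trans (sum-cong-≗ λ a →
        trans (sumWords-cong len (λ σ → ℤP.*-assoc (δ t a) _ (h (a ∷ σ))))
        (trans (sumWords-distribˡ-* len (δ t a) _) (cong (δ t a *_) (sumWords-δ len τ (h ∘ (a ∷_))))))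
      (sum-δ t (λ a → h (a ∷ τ)))

  -- On permutations, permuting positions by (i j) is permuting values by (σ i  σ j); the δ's select those values.
  sumWords-swapAt : (i j : Fin n) (h : Vec (Fin n) n → ℤ) → (∀ σ → ¬ IsPerm σ → h σ ≡ 0ℤ) →
                    sumWords n (h ∘ swapAt i j) ≡ sumWords n h
  sumWords-swapAt {n} i j h h-vanishes = begin
    sumWords n (h ∘ swapAt i j)
      ≡⟨ sumWords-cong n (λ σ → sym (sum-δ₂ (lookup σ i) (lookup σ j) _)) ⟩
    sumWords n (λ σ → sum λ a → sum λ b → δ (lookup σ i) a * (δ (lookup σ j) b * h (swapAt i j σ)))
      ≡⟨ sumWords-cong n (λ σ → sum-cong-≗ λ a → sum-cong-≗ λ b → swapAt-as-tmul σ a b (isPerm? σ) (lookup σ i ≟ a) (lookup σ j ≟ b)) ⟩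
    sumWords n (λ σ → sum λ a → sum λ b → selected σ a b)
      ≡⟨ sumWords-sum₂ n selected ⟩
    sum (λ a → sum λ b → sumWords n (λ σ → selected σ a b))
      ≡⟨ sum-cong-≗ (λ a → sum-cong-≗ λ b → trans (sym (sumWords-map-transpose n a b _)) (sumWords-cong n (relabel a b))) ⟩
    sum (λ a → sum λ b → sumWords n (λ σ → δ (lookup σ j) a * (δ (lookup σ i) b * h σ)))
      ≡⟨ sym (sumWords-sum₂ n (λ σ a b → δ (lookup σ j) a * (δ (lookup σ i) b * h σ))) ⟩
    sumWords n (λ σ → sum λ a → sum λ b → δ (lookup σ j) a * (δ (lookup σ i) b * h σ))
      ≡⟨ sumWords-cong n (λ σ → sum-δ₂ (lookup σ j) (lookup σ i) (h σ)) ⟩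
    sumWords n h ∎
    where
    open ≡-Reasoning
    selected : Vec (Fin n) n → Fin n → Fin n → ℤ
    selected σ a b = δ (lookup σ i) a * (δ (lookup σ j) b * h (tmul a b σ))

    swapAt-as-tmul : ∀ σ a b → Dec (IsPerm σ) → Dec (lookup σ i ≡ a) → Dec (lookup σ j ≡ b) →
                     δ (lookup σ i) a * (δ (lookup σ j) b * h (swapAt i j σ)) ≡ selected σ a b
    swapAt-as-tmul σ a b (no σ-not) _ _ = cong (λ x → δ (lookup σ i) a * (δ (lookup σ j) b * x))
      (trans (h-vanishes _ (σ-not ∘ IsPerm-swapAt⁻ i j σ)) (sym (h-vanishes _ (σ-not ∘ IsPerm-tmul⁻ a b σ))))
    swapAt-as-tmul σ a b (yes _) (no σi≢a) _ rewrite δ-≢ σi≢a = refl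
    swapAt-as-tmul σ a b (yes _) (yes _) (no σj≢b) rewrite δ-≢ σj≢b = refl
    swapAt-as-tmul σ a b (yes σ-inj) (yes refl) (yes refl) =
      cong (λ τ → δ (lookup σ i) a * (δ (lookup σ j) b * h τ)) (swapAt≡tmul σ σ-inj i j)

    relabel : ∀ a b σ → selected (tmul a b σ) a b ≡ δ (lookup σ j) a * (δ (lookup σ i) b * h σ)
    relabel a b σ = begin
      δ (lookup (tmul a b σ) i) a * (δ (lookup (tmul a b σ) j) b * h (tmul a b (tmul a b σ)))
        ≡⟨ cong₂ (λ x y → δ x a * (δ y b * h (tmul a b (tmul a b σ)))) (lookup-tmul a b σ i) (lookup-tmul a b σ j) ⟩
      δ (transpose a b (lookup σ i)) a * (δ (transpose a b (lookup σ j)) b * h (tmul a b (tmul a b σ)))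
        ≡⟨ cong₂ (λ x y → x * (y * h (tmul a b (tmul a b σ)))) (δ-transpose a b (lookup σ i) a) (δ-transpose a b (lookup σ j) b) ⟩
      δ (lookup σ i) (transpose a b a) * (δ (lookup σ j) (transpose a b b) * h (tmul a b (tmul a b σ)))
        ≡⟨ cong₂ (λ x y → δ (lookup σ i) x * (δ (lookup σ j) y * h (tmul a b (tmul a b σ))))
                 (transpose-matchˡ a b) (transpose-matchʳ a b) ⟩
      δ (lookup σ i) b * (δ (lookup σ j) a * h (tmul a b (tmul a b σ)))
        ≡⟨ cong (λ τ → δ (lookup σ i) b * (δ (lookup σ j) a * h τ)) (tmul-involutive a b σ) ⟩
      δ (lookup σ i) b * (δ (lookup σ j) a * h σ)
        ≡⟨ ring (δ (lookup σ i) b) (δ (lookup σ j) a) (h σ) ⟩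
      δ (lookup σ j) a * (δ (lookup σ i) b * h σ) ∎
      where
      ring : ∀ x y z → x * (y * z) ≡ y * (x * z)
      ring = solve-∀

  sumPairs : (Fin n → Fin n → ℤ) → ℤ
  sumPairs F = sum λ a → sum λ b → if toℕ a ℕ.<ᵇ toℕ b then F a b else 0ℤ

  adj≡sumPairs : (v : Vec (Fin n) n → ℤ) (f : Vec (Fin n) n) → adj v f ≡ sumPairs (λ a b → v (tmul a b f))
  adj≡sumPairs v f = trans (Σℤ≡sum (λ a → Σℤ (row a))) (sum-cong-≗ λ a → Σℤ≡sum (row a))
    where
    row : Fin _ → Fin _ → ℤ
    row a b = if toℕ a ℕ.<ᵇ toℕ b then v (tmul a b f) else 0ℤ

  sumPairs-cong : {F G : Fin n → Fin n → ℤ} → (∀ a b → F a b ≡ G a b) → sumPairs F ≡ sumPairs G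
  sumPairs-cong F≗G = sum-cong-≗ λ a → sum-cong-≗ λ b → cong (λ x → if toℕ a ℕ.<ᵇ toℕ b then x else 0ℤ) (F≗G a b)

  sumPairs-suc : (F : Fin (suc n) → Fin (suc n) → ℤ) →
                 sumPairs F ≡ sum (λ b → F zero (suc b)) + sumPairs (λ a b → F (suc a) (suc b))
  sumPairs-suc F = cong₂ _+_ (ℤP.+-identityˡ (sum (λ b → F zero (suc b))))
    (sum-cong-≗ λ a → ℤP.+-identityˡ (sum λ b → if toℕ a ℕ.<ᵇ toℕ b then F (suc a) (suc b) else 0ℤ))

  sumPairs-↑ : ∀ {m k} (F : Fin (m ℕ.+ k) → Fin (m ℕ.+ k) → ℤ) →
    sumPairs F ≡ (sumPairs (λ a b → F (a ↑ˡ k) (b ↑ˡ k)) + sum (λ a → sum λ c → F (a ↑ˡ k) (m ↑ʳ c)))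
                 + sumPairs (λ c c′ → F (m ↑ʳ c) (m ↑ʳ c′))
  sumPairs-↑ {zero} F = sym (ℤP.+-identityˡ _)
  sumPairs-↑ {suc m} {k} F = begin
    sumPairs F
      ≡⟨ sumPairs-suc F ⟩
    sum (λ b → F zero (suc b)) + sumPairs (λ a b → F (suc a) (suc b))
      ≡⟨ cong₂ _+_ (sum-↑ {m} {k} (F zero ∘ suc)) (sumPairs-↑ {m} {k} (λ a b → F (suc a) (suc b))) ⟩
    (top-old + top-new) + ((old + cross) + new)
      ≡⟨ ring top-old top-new old cross new ⟩
    ((top-old + old) + (top-new + cross)) + new
      ≡⟨ cong (λ x → (x + (top-new + cross)) + new) (sym (sumPairs-suc (λ a b → F (a ↑ˡ k) (b ↑ˡ k)))) ⟩
    (sumPairs (λ a b → F (a ↑ˡ k) (b ↑ˡ k)) + (top-new + cross)) + new ∎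
    where
    open ≡-Reasoning
    top-old top-new old cross new : ℤ
    top-old = sum (λ b → F zero (suc (b ↑ˡ k)))
    top-new = sum (λ c → F zero (suc (m ↑ʳ c)))
    old = sumPairs (λ a b → F (suc (a ↑ˡ k)) (suc (b ↑ˡ k)))
    cross = sum (λ a → sum λ c → F (suc (a ↑ˡ k)) (suc (m ↑ʳ c)))
    new = sumPairs (λ c c′ → F (suc (m ↑ʳ c)) (suc (m ↑ʳ c′)))
    ring : ∀ x₁ x₂ o c n → (x₁ + x₂) + ((o + c) + n) ≡ ((x₁ + o) + (x₂ + c)) + n
    ring = solve-∀

  suc-C2 : ∀ k → suc k C 2 ≡ k ℕ.+ k C 2
  suc-C2 k = trans (sym (nCk+nC[k+1]≡[n+1]C[k+1] k 1)) (cong (ℕ._+ k C 2) (nC1≡n k))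

  sumPairs-const : ∀ k (x : ℤ) → sumPairs {k} (λ _ _ → x) ≡ + (k C 2) * x
  sumPairs-const zero x = refl
  sumPairs-const (suc k) x = begin
    sumPairs {suc k} (λ _ _ → x)             ≡⟨ sumPairs-suc {k} (λ _ _ → x) ⟩
    sum {k} (λ _ → x) + sumPairs {k} (λ _ _ → x) ≡⟨ cong₂ _+_ (sum-const k x) (sumPairs-const k x) ⟩
    + k * x + + (k C 2) * x                  ≡⟨ sym (ℤP.*-distribʳ-+ x (+ k) (+ (k C 2))) ⟩
    (+ k + + (k C 2)) * x                    ≡⟨ cong (λ y → y * x) (sym (cong +_ (suc-C2 k))) ⟩
    + (suc k C 2) * x                        ∎
    where open ≡-Reasoning

  sumPairs-sumWords : ∀ {m} len (h : Fin n → Fin n → Vec (Fin m) len → ℤ) →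
    sumPairs (λ a b → sumWords len (h a b)) ≡ sumWords len (λ σ → sumPairs (λ a b → h a b σ))
  sumPairs-sumWords {m = m} len h = trans (sum-cong-≗ λ a → sum-cong-≗ λ b → if-sumWords (toℕ a ℕ.<ᵇ toℕ b) (h a b))
    (sym (sumWords-sum₂ len (λ σ a b → if toℕ a ℕ.<ᵇ toℕ b then h a b σ else 0ℤ)))
    where
    if-sumWords : ∀ c (g : Vec (Fin m) len → ℤ) → (if c then sumWords len g else 0ℤ) ≡ sumWords len (λ σ → if c then g σ else 0ℤ)
    if-sumWords true g = refl
    if-sumWords false g = sym (sumWords-zero len (λ _ → refl))

  sumPairs-*ʳ : (F : Fin n → Fin n → ℤ) (x : ℤ) → sumPairs (λ a b → F a b * x) ≡ sumPairs F * x
  sumPairs-*ʳ F x = trans (sum-cong-≗ λ a → trans (sum-cong-≗ λ b → if-* (toℕ a ℕ.<ᵇ toℕ b) (F a b))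
    (sym (*-distribʳ-sum x (λ b → if toℕ a ℕ.<ᵇ toℕ b then F a b else 0ℤ))))
    (sym (*-distribʳ-sum x (λ a → sum λ b → if toℕ a ℕ.<ᵇ toℕ b then F a b else 0ℤ)))
    where
    if-* : ∀ c y → (if c then y * x else 0ℤ) ≡ (if c then y else 0ℤ) * x
    if-* true y = refl
    if-* false y = sym (ℤP.*-zeroˡ x)

  i≡-i⇒i≡0 : (x : ℤ) → x ≡ - x → x ≡ 0ℤ
  i≡-i⇒i≡0 x x≡-x = ℤP.*-cancelˡ-≡ (+ 2) x 0ℤ (trans (ring x) (trans (cong (_+_ x) x≡-x) (ℤP.+-inverseʳ x)))
    where
    ring : ∀ x → + 2 * x ≡ x + x
    ring = solve-∀

  data SplitView (m k : ℕ) : Fin (m ℕ.+ k) → Set where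
    inˡ : (i : Fin m) → SplitView m k (i ↑ˡ k)
    inʳ : (c : Fin k) → SplitView m k (m ↑ʳ c)

  splitView : ∀ m k (p : Fin (m ℕ.+ k)) → SplitView m k p
  splitView zero k p = inʳ p
  splitView (suc m) k zero = inˡ zero
  splitView (suc m) k (suc p) with splitView m k p
  ... | inˡ i = inˡ (suc i)
  ... | inʳ c = inʳ c

  ↑ˡ≢↑ʳ : ∀ {m k} (i : Fin m) (c : Fin k) → i ↑ˡ k ≢ m ↑ʳ c
  ↑ˡ≢↑ʳ {suc m} zero c ()
  ↑ˡ≢↑ʳ {suc m} (suc i) c e = ↑ˡ≢↑ʳ i c (FinP.suc-injective e)

  -- Adding a row on top of a Young diagram

  -- A vector on S_m attached to a Young diagram whose m cells are numbered by Fin m and lie in columns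
  -- numbered by Fin L: σ is read as the filling of cell l by the value σ(l).
  record ColumnEigenvector (m L : ℕ) (γ : ℤ) : Set where
    field
      vec : Vec (Fin m) m → ℤ
      column : Fin m → Fin L
      eigen : ∀ σ → IsPerm σ → adj vec σ ≡ γ * vec σ
      antisym : ∀ σ {i j} → i ≢ j → column i ≡ column j → vec (swapAt i j σ) ≡ - vec σ
      vanishes : ∀ σ → ¬ IsPerm σ → vec σ ≡ 0ℤ
      nonzero : vec idPerm ≢ 0ℤ

  widen : ∀ {m L k γ} → L ℕ.≤ k → ColumnEigenvector m L γ → ColumnEigenvector m k γ
  widen L≤k E = record
    { vec = vec ; column = λ i → Fin.inject≤ (column i) L≤k ; eigen = eigen
    ; antisym = λ σ i≢j same → antisym σ i≢j (FinP.inject≤-injective L≤k L≤k _ _ same)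
    ; vanishes = vanishes ; nonzero = nonzero }
    where open ColumnEigenvector E

  eigen-everywhere : ∀ {γ} (χ : Vec (Fin n) n → ℤ) → (∀ σ → IsPerm σ → adj χ σ ≡ γ * χ σ) →
                     (∀ σ → ¬ IsPerm σ → χ σ ≡ 0ℤ) → ∀ σ t → adj χ σ * t ≡ γ * (χ σ * t)
  eigen-everywhere {n} {γ = γ} χ eigen vanishes σ t with isPerm? σ
  ... | yes σ-perm = trans (cong (_* t) (eigen σ σ-perm)) (ℤP.*-assoc γ (χ σ) t)
  ... | no σ-not = trans (cong (_* t) adj≡0) (trans (ℤP.*-zeroˡ t) (sym (trans (cong (λ x → γ * (x * t)) (vanishes σ σ-not))
                     (trans (cong (γ *_) (ℤP.*-zeroˡ t)) (ℤP.*-zeroʳ γ)))))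
    where
    adj≡0 : adj χ σ ≡ 0ℤ
    adj≡0 = trans (adj≡sumPairs χ σ) (trans (sumPairs-cong (λ a b → vanishes _ (σ-not ∘ IsPerm-tmul⁻ a b σ)))
                  (trans (sumPairs-const n 0ℤ) (ℤP.*-zeroʳ (+ (n C 2)))))

  -- The new row is put on top of the diagram: `new c` is its cell in column c, lying above every `old l` with
  -- col l = c.  The lifted vector antisymmetrises each old cell against the new cell of its column.
  module AddRow {m k : ℕ} {γ : ℤ} (E : ColumnEigenvector m k γ) where

    open ColumnEigenvector E renaming (vec to χ; column to col; eigen to χ-eigen; antisym to χ-antisym; vanishes to χ-vanishes)

    N : ℕ
    N = m ℕ.+ k

    old : Fin m → Fin N
    old i = i ↑ˡ k

    new : Fin k → Fin N
    new c = m ↑ʳ c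

    old-injective : {i j : Fin m} → i ≢ j → old i ≢ old j
    old-injective i≢j = i≢j ∘ FinP.↑ˡ-injective k _ _

    new-injective : {c c′ : Fin k} → c ≢ c′ → new c ≢ new c′
    new-injective c≢c′ = c≢c′ ∘ FinP.↑ʳ-injective m _ _

    new≢old : {c : Fin k} {i : Fin m} → new c ≢ old i
    new≢old {c} {i} = ↑ˡ≢↑ʳ i c ∘ sym

    columnDiff : Vec (Fin N) N → Fin m → Fin N → ℤ
    columnDiff f l u = δ (lookup f (old l)) u - δ (lookup f (new (col l))) u

    factor : Vec (Fin N) N → Vec (Fin m) m → Fin m → ℤ
    factor f σ l = columnDiff f l (old (lookup σ l))

    weight : Vec (Fin N) N → Vec (Fin m) m → ℤ
    weight f σ = product (factor f σ)

    lifted : Vec (Fin N) N → ℤ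
    lifted f = sumWords m λ σ → χ σ * weight f σ

    columnDiff-tmul : ∀ f a b l u → columnDiff (tmul a b f) l u ≡ columnDiff f l (transpose a b u)
    columnDiff-tmul f a b l u = cong₂ _-_
      (trans (cong (λ x → δ x u) (lookup-tmul a b f (old l))) (δ-transpose a b (lookup f (old l)) u))
      (trans (cong (λ x → δ x u) (lookup-tmul a b f (new (col l)))) (δ-transpose a b (lookup f (new (col l))) u))

    lifted-tmul : ∀ f a b →
                  lifted (tmul a b f) ≡ sumWords m (λ σ → χ σ * product (λ l → columnDiff f l (transpose a b (old (lookup σ l)))))
    lifted-tmul f a b = sumWords-cong m λ σ → cong (χ σ *_) (Product.sum-cong-≗ λ l → columnDiff-tmul f a b l _)

    transpose-old-old : ∀ a b u → transpose (old a) (old b) (old u) ≡ old (transpose a b u)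
    transpose-old-old a b u = by-cases (u ≟ a) (u ≟ b)
      where
      by-cases : Dec (u ≡ a) → Dec (u ≡ b) → transpose (old a) (old b) (old u) ≡ old (transpose a b u)
      by-cases (yes refl) _ = trans (transpose-matchˡ (old u) (old b)) (cong old (sym (transpose-matchˡ u b)))
      by-cases (no _) (yes refl) = trans (transpose-matchʳ (old a) (old u)) (cong old (sym (transpose-matchʳ a u)))
      by-cases (no u≢a) (no u≢b) =
        trans (transpose-mismatch (old-injective u≢a) (old-injective u≢b)) (cong old (sym (transpose-mismatch u≢a u≢b)))

    transpose-new-new : ∀ c c′ u → transpose (new c) (new c′) (old u) ≡ old u
    transpose-new-new c c′ u = transpose-mismatch (↑ˡ≢↑ʳ u c) (↑ˡ≢↑ʳ u c′)

    transpose-old-new : ∀ a c u → transpose (old a) (new c) (old u) ≡ (if does (u ≟ a) then new c else old u)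
    transpose-old-new a c u with u ≟ a
    ... | yes refl = transpose-matchˡ (old u) (new c)
    ... | no u≢a = transpose-mismatch (old-injective u≢a) (↑ˡ≢↑ʳ u c)

    new-new-block : ∀ f → sumPairs (λ c c′ → lifted (tmul (new c) (new c′) f)) ≡ + (k C 2) * lifted f
    new-new-block f = trans (sumPairs-cong λ c c′ → trans (lifted-tmul f (new c) (new c′))
        (sumWords-cong m λ σ → cong (χ σ *_) (Product.sum-cong-≗ λ l → cong (columnDiff f l) (transpose-new-new c c′ _))))
      (sumPairs-const k (lifted f))

    lifted-tmul-old : ∀ f a b → lifted (tmul (old a) (old b) f) ≡ sumWords m (λ σ → χ (tmul a b σ) * weight f σ)
    lifted-tmul-old f a b = begin
      lifted (tmul (old a) (old b) f)
        ≡⟨ lifted-tmul f (old a) (old b) ⟩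
      sumWords m (λ σ → χ σ * product (λ l → columnDiff f l (transpose (old a) (old b) (old (lookup σ l)))))
        ≡⟨ sumWords-cong m (λ σ → cong (χ σ *_) (Product.sum-cong-≗ λ l → cong (columnDiff f l)
             (trans (transpose-old-old a b (lookup σ l)) (cong old (sym (lookup-tmul a b σ l)))))) ⟩
      sumWords m (λ σ → χ σ * weight f (tmul a b σ))
        ≡⟨ sumWords-cong m (λ σ → cong (λ τ → χ τ * weight f (tmul a b σ)) (sym (tmul-involutive a b σ))) ⟩
      sumWords m (λ σ → χ (tmul a b (tmul a b σ)) * weight f (tmul a b σ))
        ≡⟨ sumWords-map-transpose m a b (λ σ → χ (tmul a b σ) * weight f σ) ⟩
      sumWords m (λ σ → χ (tmul a b σ) * weight f σ) ∎
      where open ≡-Reasoning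

    old-old-block : ∀ f → sumPairs (λ a b → lifted (tmul (old a) (old b) f)) ≡ γ * lifted f
    old-old-block f = begin
      sumPairs (λ a b → lifted (tmul (old a) (old b) f))
        ≡⟨ sumPairs-cong (lifted-tmul-old f) ⟩
      sumPairs (λ a b → sumWords m (λ σ → χ (tmul a b σ) * weight f σ))
        ≡⟨ sumPairs-sumWords m (λ a b σ → χ (tmul a b σ) * weight f σ) ⟩
      sumWords m (λ σ → sumPairs (λ a b → χ (tmul a b σ) * weight f σ))
        ≡⟨ sumWords-cong m (λ σ → trans (sumPairs-*ʳ (λ a b → χ (tmul a b σ)) (weight f σ))
                                         (cong (_* weight f σ) (sym (adj≡sumPairs χ σ)))) ⟩
      sumWords m (λ σ → adj χ σ * weight f σ)
        ≡⟨ sumWords-cong m (λ σ → eigen-everywhere {γ = γ} χ χ-eigen χ-vanishes σ (weight f σ)) ⟩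
      sumWords m (λ σ → γ * (χ σ * weight f σ))
        ≡⟨ sumWords-distribˡ-* m γ _ ⟩
      γ * lifted f ∎
      where open ≡-Reasoning

    χ*-cong : {X Y : Vec (Fin m) m → ℤ} → (∀ σ → IsPerm σ → X σ ≡ Y σ) → ∀ σ → χ σ * X σ ≡ χ σ * Y σ
    χ*-cong X≡Y σ with isPerm? σ
    ... | yes σ-perm = cong (χ σ *_) (X≡Y σ σ-perm)
    ... | no σ-not = trans (cong (_* _) (χ-vanishes σ σ-not)) (sym (cong (_* _) (χ-vanishes σ σ-not)))

    sum-χ-swapAt : ∀ {i j} → i ≢ j → col i ≡ col j → (h : Vec (Fin m) m → ℤ) →
                   sumWords m (λ σ → χ σ * h (swapAt i j σ)) ≡ - sumWords m (λ σ → χ σ * h σ)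
    sum-χ-swapAt {i} {j} i≢j same h = begin
      sumWords m (λ σ → χ σ * h (swapAt i j σ))
        ≡⟨ sumWords-cong m (λ σ → cong (λ τ → χ τ * h (swapAt i j σ)) (sym (swapAt-involutive i j σ))) ⟩
      sumWords m (λ σ → χ (swapAt i j (swapAt i j σ)) * h (swapAt i j σ))
        ≡⟨ sumWords-swapAt i j (λ σ → χ (swapAt i j σ) * h σ)
             (λ σ σ-not → trans (cong (_* h σ) (χ-vanishes _ (σ-not ∘ IsPerm-swapAt⁻ i j σ))) (ℤP.*-zeroˡ (h σ))) ⟩
      sumWords m (λ σ → χ (swapAt i j σ) * h σ)
        ≡⟨ sumWords-cong m (λ σ → trans (cong (_* h σ) (χ-antisym σ i≢j same)) (sym (ℤP.neg-distribˡ-* (χ σ) (h σ)))) ⟩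
      sumWords m (λ σ → - (χ σ * h σ))
        ≡⟨ sumWords-neg m _ ⟩
      - sumWords m (λ σ → χ σ * h σ) ∎
      where open ≡-Reasoning

    sum-χ-invariant : ∀ {i j} → i ≢ j → col i ≡ col j → (h : Vec (Fin m) m → ℤ) →
                      (∀ σ → h (swapAt i j σ) ≡ h σ) → sumWords m (λ σ → χ σ * h σ) ≡ 0ℤ
    sum-χ-invariant i≢j same h invariant = i≡-i⇒i≡0 _
      (trans (sym (sumWords-cong m λ σ → cong (χ σ *_) (invariant σ))) (sum-χ-swapAt i≢j same h))

    cofactor : Vec (Fin N) N → Vec (Fin m) m → Fin m → ℤ
    cofactor f σ i = product (factor f σ except i)

    cofactor₂ : Vec (Fin N) N → Vec (Fin m) m → Fin m → Fin m → ℤ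
    cofactor₂ f σ i j = product ((factor f σ except i) except j)

    crossTerm : Vec (Fin N) N → Vec (Fin m) m → Fin m → Fin m → ℤ
    crossTerm f σ i j = (1ℤ - δ i j) * (columnDiff f i (old (lookup σ j)) * (factor f σ j * cofactor₂ f σ i j))

    sum-columnDiff-new : ∀ f l → sum (λ c → columnDiff f l (new c)) ≡ - sum (λ u → columnDiff f l (old u))
    sum-columnDiff-new f l = trans (ring (sum (λ u → columnDiff f l (old u))) (sum (λ c → columnDiff f l (new c))))
      (trans (cong (λ s → - sum (λ u → columnDiff f l (old u)) + s) (trans (sym (sum-↑ {m} {k} (columnDiff f l))) sum≡0))
             (ℤP.+-identityʳ _))
      where
      ring : ∀ a b → b ≡ - a + (a + b)
      ring = solve-∀
      sum≡0 : sum (columnDiff f l) ≡ 0ℤ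
      sum≡0 = begin
        sum (λ u → δ (lookup f (old l)) u - δ (lookup f (new (col l))) u)
          ≡⟨ ∑-distrib-+ (δ (lookup f (old l))) (λ u → - δ (lookup f (new (col l))) u) ⟩
        sum (δ (lookup f (old l))) + sum (λ u → - δ (lookup f (new (col l))) u)
          ≡⟨ cong₂ _+_ (sum-δ₁ (lookup f (old l)))
                     (trans (sum-neg (δ (lookup f (new (col l))))) (cong -_ (sum-δ₁ (lookup f (new (col l)))))) ⟩
        0ℤ ∎
        where open ≡-Reasoning

    sum-old-new : ∀ f σ → IsPerm σ → ∀ c →
      sum (λ a → product (λ l → columnDiff f l (transpose (old a) (new c) (old (lookup σ l)))))
        ≡ sum (λ i → columnDiff f i (new c) * cofactor f σ i)
    sum-old-new f σ σ-inj c = begin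
      sum (λ a → product (λ l → columnDiff f l (transpose (old a) (new c) (old (lookup σ l)))))
        ≡⟨ sum-cong-≗ (λ a → Product.sum-cong-≗ λ l → cong (columnDiff f l) (transpose-old-new a c (lookup σ l))) ⟩
      sum (λ a → product (λ l → columnDiff f l (if does (lookup σ l ≟ a) then new c else old (lookup σ l))))
        ≡⟨ sym (sum-lookup σ σ-inj _) ⟩
      sum (λ i → product (λ l → columnDiff f l (if does (lookup σ l ≟ lookup σ i) then new c else old (lookup σ l))))
        ≡⟨ sum-cong-≗ (λ i → Product.sum-cong-≗ λ l → cong (columnDiff f l) (does-≟-injective σ-inj l i (new c) _)) ⟩
      sum (λ i → product (replaced i))
        ≡⟨ sum-cong-≗ (λ i → trans (product-pick (replaced i) i) (cong₂ _*_ (at-i i) (Product.sum-cong-≗ (except-cong i (off-i i))))) ⟩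
      sum (λ i → columnDiff f i (new c) * cofactor f σ i) ∎
      where
      open ≡-Reasoning
      replaced : Fin m → Fin m → ℤ
      replaced i l = columnDiff f l (if does (l ≟ i) then new c else old (lookup σ l))
      at-i : ∀ i → replaced i i ≡ columnDiff f i (new c)
      at-i i rewrite dec-true (i ≟ i) refl = refl
      off-i : ∀ i l → l ≢ i → replaced i l ≡ factor f σ l
      off-i i l l≢i rewrite dec-false (l ≟ i) l≢i = refl

    cofactor-pick : ∀ f σ i j → (1ℤ - δ i j) * (columnDiff f i (old (lookup σ j)) * cofactor f σ i) ≡ crossTerm f σ i j
    cofactor-pick f σ i j with i ≟ j
    ... | yes refl = refl
    ... | no i≢j = cong (λ x → (1ℤ - 0ℤ) * (columnDiff f i (old (lookup σ j)) * x))
      (trans (product-pick (factor f σ except i) j) (cong (_* cofactor₂ f σ i j) (except-≢ (factor f σ) (i≢j ∘ sym))))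

    -- The value a sits in some old cell i, where it is replaced by new c; summing over c turns that factor into
    -- − Σ_j columnDiff f i (old (σ j)), whose term j = i gives back weight f σ.
    cross-weight : ∀ f σ → IsPerm σ →
      sum (λ a → sum λ c → product (λ l → columnDiff f l (transpose (old a) (new c) (old (lookup σ l)))))
        ≡ - (+ m * weight f σ + sum (λ i → sum (crossTerm f σ i)))
    cross-weight f σ σ-inj = begin
      sum (λ a → sum λ c → Q a c)
        ≡⟨ ∑-comm Q ⟩
      sum (λ c → sum λ a → Q a c)
        ≡⟨ sum-cong-≗ (sum-old-new f σ σ-inj) ⟩
      sum (λ c → sum λ i → columnDiff f i (new c) * cofactor f σ i)
        ≡⟨ ∑-comm (λ c i → columnDiff f i (new c) * cofactor f σ i) ⟩
      sum (λ i → sum λ c → columnDiff f i (new c) * cofactor f σ i)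
        ≡⟨ sum-cong-≗ (λ i → sym (*-distribʳ-sum (cofactor f σ i) (λ c → columnDiff f i (new c)))) ⟩
      sum (λ i → sum (λ c → columnDiff f i (new c)) * cofactor f σ i)
        ≡⟨ sum-cong-≗ (λ i → cong (_* cofactor f σ i)
             (trans (sum-columnDiff-new f i) (cong -_ (sym (sum-lookup σ σ-inj (λ u → columnDiff f i (old u))))))) ⟩
      sum (λ i → - sum (λ j → columnDiff f i (old (lookup σ j))) * cofactor f σ i)
        ≡⟨ sum-cong-≗ (λ i → trans (sym (ℤP.neg-distribˡ-* (sum (λ j → columnDiff f i (old (lookup σ j)))) (cofactor f σ i)))
                                    (cong -_ (*-distribʳ-sum (cofactor f σ i) (λ j → columnDiff f i (old (lookup σ j)))))) ⟩
      sum (λ i → - sum λ j → columnDiff f i (old (lookup σ j)) * cofactor f σ i)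
        ≡⟨ sum-neg (λ i → sum λ j → columnDiff f i (old (lookup σ j)) * cofactor f σ i) ⟩
      - sum (λ i → sum λ j → columnDiff f i (old (lookup σ j)) * cofactor f σ i)
        ≡⟨ cong -_ (sum-cong-≗ λ i → trans (sum-split-at i _)
             (cong₂ _+_ (sym (product-pick (factor f σ) i)) (sum-cong-≗ (cofactor-pick f σ i)))) ⟩
      - sum (λ i → weight f σ + sum (crossTerm f σ i))
        ≡⟨ cong -_ (trans (∑-distrib-+ (λ _ → weight f σ) (λ i → sum (crossTerm f σ i)))
                          (cong (_+ sum (λ i → sum (crossTerm f σ i))) (sum-const m (weight f σ)))) ⟩
      - (+ m * weight f σ + sum (λ i → sum (crossTerm f σ i))) ∎
      where
      open ≡-Reasoning
      Q : Fin m → Fin k → ℤ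
      Q a c = product (λ l → columnDiff f l (transpose (old a) (new c) (old (lookup σ l))))

    -- The cells old i, new (col i), old j, new (col j) are distinct, and f is injective.
    columnDiff-orthogonal : ∀ f → IsPerm f → ∀ {i j} → i ≢ j → col i ≢ col j → ∀ u →
                            columnDiff f i u * columnDiff f j u ≡ 0ℤ
    columnDiff-orthogonal f f-inj {i} {j} i≢j cols≢ u = begin
      (x - y) * (z - w)                  ≡⟨ ring x y z w ⟩
      (x * z - x * w) - (y * z - y * w)  ≡⟨ cong₂ _-_ (cong₂ _-_ (apart (old-injective i≢j)) (apart (↑ˡ≢↑ʳ i (col j))))
                                                      (cong₂ _-_ (apart (↑ˡ≢↑ʳ j (col i) ∘ sym)) (apart (new-injective cols≢))) ⟩
      0ℤ                                 ∎
      where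
      open ≡-Reasoning
      x y z w : ℤ
      x = δ (lookup f (old i)) u
      y = δ (lookup f (new (col i))) u
      z = δ (lookup f (old j)) u
      w = δ (lookup f (new (col j))) u
      ring : ∀ x y z w → (x - y) * (z - w) ≡ (x * z - x * w) - (y * z - y * w)
      ring = solve-∀
      apart : ∀ {p q} → p ≢ q → δ (lookup f p) u * δ (lookup f q) u ≡ 0ℤ
      apart p≢q = δ*δ≡0 (p≢q ∘ f-inj _ _) u

    crossTerm-diagonal : ∀ f σ i → crossTerm f σ i i ≡ 0ℤ
    crossTerm-diagonal f σ i rewrite δ-refl i = refl

    crossTerm-columns : ∀ f → IsPerm f → ∀ σ {i j} → i ≢ j → col i ≢ col j → crossTerm f σ i j ≡ 0ℤ
    crossTerm-columns f f-inj σ {i} {j} i≢j cols≢ =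
      trans (cong ((1ℤ - δ i j) *_) (trans (sym (ℤP.*-assoc (columnDiff f i (old (lookup σ j))) (factor f σ j) (cofactor₂ f σ i j)))
                                          (trans (cong (_* cofactor₂ f σ i j) (columnDiff-orthogonal f f-inj i≢j cols≢ (old (lookup σ j))))
                                                 (ℤP.*-zeroˡ (cofactor₂ f σ i j)))))
            (ℤP.*-zeroʳ (1ℤ - δ i j))

    cofactor₂-swapAt : ∀ f σ i j → cofactor₂ f (swapAt i j σ) i j ≡ cofactor₂ f σ j i
    cofactor₂-swapAt f σ i j = Product.sum-cong-≗ λ l → by-cases l (l ≟ i) (l ≟ j)
      where
      by-cases : ∀ l → Dec (l ≡ i) → Dec (l ≡ j) →
                 ((factor f (swapAt i j σ) except i) except j) l ≡ ((factor f σ except j) except i) l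
      by-cases l (yes refl) (yes refl) rewrite dec-true (l ≟ l) refl = refl
      by-cases l (yes refl) (no l≢j) rewrite dec-true (l ≟ l) refl | dec-false (l ≟ j) l≢j = refl
      by-cases l (no l≢i) (yes refl) rewrite dec-true (l ≟ l) refl | dec-false (l ≟ i) l≢i = refl
      by-cases l (no l≢i) (no l≢j) rewrite dec-false (l ≟ i) l≢i | dec-false (l ≟ j) l≢j =
        cong (λ x → columnDiff f l (old x)) (trans (lookup-swapAt i j σ l) (cong (lookup σ) (transpose-mismatch l≢i l≢j)))

    crossTerm-swapAt : ∀ f σ i j → crossTerm f (swapAt i j σ) i j ≡ crossTerm f σ j i
    crossTerm-swapAt f σ i j = begin
      (1ℤ - δ i j) * (columnDiff f i (old (lookup σ′ j)) * (columnDiff f j (old (lookup σ′ j)) * cofactor₂ f σ′ i j))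
        ≡⟨ cong₂ (λ d x → (1ℤ - d) * (columnDiff f i (old x) * (columnDiff f j (old x) * cofactor₂ f σ′ i j)))
                 (δ-sym i j) σ′j≡σi ⟩
      (1ℤ - δ j i) * (columnDiff f i (old (lookup σ i)) * (columnDiff f j (old (lookup σ i)) * cofactor₂ f σ′ i j))
        ≡⟨ cong ((1ℤ - δ j i) *_) (ring (columnDiff f i (old (lookup σ i))) (columnDiff f j (old (lookup σ i))) (cofactor₂ f σ′ i j)) ⟩
      (1ℤ - δ j i) * (columnDiff f j (old (lookup σ i)) * (columnDiff f i (old (lookup σ i)) * cofactor₂ f σ′ i j))
        ≡⟨ cong (λ x → (1ℤ - δ j i) * (columnDiff f j (old (lookup σ i)) * (columnDiff f i (old (lookup σ i)) * x)))
                (cofactor₂-swapAt f σ i j) ⟩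
      crossTerm f σ j i ∎
      where
      open ≡-Reasoning
      σ′ = swapAt i j σ
      σ′j≡σi : lookup σ′ j ≡ lookup σ i
      σ′j≡σi = trans (lookup-swapAt i j σ j) (cong (lookup σ) (transpose-matchʳ i j))
      ring : ∀ x y z → x * (y * z) ≡ y * (x * z)
      ring = solve-∀

    crossSum : Vec (Fin N) N → Fin m → Fin m → ℤ
    crossSum f i j = sumWords m (λ σ → χ σ * crossTerm f σ i j)

    crossSum-antisym : ∀ f → IsPerm f → ∀ i j → crossSum f i j ≡ - crossSum f j i
    crossSum-antisym f f-inj i j = by-cases (i ≟ j) (col i ≟ col j)
      where
      vanishing : ∀ a b → (∀ σ → crossTerm f σ a b ≡ 0ℤ) → crossSum f a b ≡ 0ℤ
      vanishing a b crossTerm≡0 = sumWords-zero m (λ σ → trans (cong (χ σ *_) (crossTerm≡0 σ)) (ℤP.*-zeroʳ (χ σ)))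
      by-cases : Dec (i ≡ j) → Dec (col i ≡ col j) → crossSum f i j ≡ - crossSum f j i
      by-cases (yes refl) _ = trans (vanishing i i (λ σ → crossTerm-diagonal f σ i))
                                    (cong -_ (sym (vanishing i i (λ σ → crossTerm-diagonal f σ i))))
      by-cases (no i≢j) (no cols≢) = trans (vanishing i j (λ σ → crossTerm-columns f f-inj σ i≢j cols≢))
                                           (cong -_ (sym (vanishing j i (λ σ → crossTerm-columns f f-inj σ (i≢j ∘ sym) (cols≢ ∘ sym)))))
      by-cases (no i≢j) (yes same) = begin
        crossSum f i j
          ≡⟨ sym (ℤP.neg-involutive _) ⟩
        - - sumWords m (λ σ → χ σ * crossTerm f σ i j)
          ≡⟨ cong -_ (sym (sum-χ-swapAt i≢j same (λ σ → crossTerm f σ i j))) ⟩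
        - sumWords m (λ σ → χ σ * crossTerm f (swapAt i j σ) i j)
          ≡⟨ cong -_ (sumWords-cong m (λ σ → cong (χ σ *_) (crossTerm-swapAt f σ i j))) ⟩
        - crossSum f j i ∎
        where open ≡-Reasoning

    sum-crossSum : ∀ f → IsPerm f → sum (λ i → sum (crossSum f i)) ≡ 0ℤ
    sum-crossSum f f-inj = i≡-i⇒i≡0 _ (begin
      sum (λ i → sum λ j → crossSum f i j)    ≡⟨ sum-cong-≗ (λ i → sum-cong-≗ λ j → crossSum-antisym f f-inj i j) ⟩
      sum (λ i → sum λ j → - crossSum f j i)  ≡⟨ sum-cong-≗ (λ i → sum-neg (λ j → crossSum f j i)) ⟩
      sum (λ i → - sum λ j → crossSum f j i)  ≡⟨ sum-neg (λ i → sum λ j → crossSum f j i) ⟩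
      - sum (λ i → sum λ j → crossSum f j i)  ≡⟨ cong -_ (∑-comm (λ i j → crossSum f j i)) ⟩
      - sum (λ j → sum λ i → crossSum f j i)  ∎)
      where open ≡-Reasoning

    old-new-block : ∀ f → IsPerm f → sum (λ a → sum λ c → lifted (tmul (old a) (new c) f)) ≡ - (+ m * lifted f)
    old-new-block f f-inj = begin
      sum (λ a → sum λ c → lifted (tmul (old a) (new c) f))
        ≡⟨ sum-cong-≗ (λ a → sum-cong-≗ λ c → lifted-tmul f (old a) (new c)) ⟩
      sum (λ a → sum λ c → sumWords m (λ σ → χ σ * Q σ a c))
        ≡⟨ sym (sumWords-sum₂ m (λ σ a c → χ σ * Q σ a c)) ⟩
      sumWords m (λ σ → sum λ a → sum λ c → χ σ * Q σ a c)
        ≡⟨ sumWords-cong m (λ σ → trans (sum-cong-≗ λ a → sym (*-distribˡ-sum (χ σ) (Q σ a)))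
                                      (sym (*-distribˡ-sum (χ σ) (λ a → sum (Q σ a))))) ⟩
      sumWords m (λ σ → χ σ * sum (λ a → sum (Q σ a)))
        ≡⟨ sumWords-cong m (χ*-cong (cross-weight f)) ⟩
      sumWords m (λ σ → χ σ * - (+ m * weight f σ + sum (λ i → sum (crossTerm f σ i))))
        ≡⟨ sumWords-cong m (λ σ → trans (ring (χ σ) (+ m) (weight f σ) (sum (λ i → sum (crossTerm f σ i))))
             (cong (λ s → - (+ m * (χ σ * weight f σ)) + - s)
               (trans (*-distribˡ-sum (χ σ) (λ i → sum (crossTerm f σ i))) (sum-cong-≗ λ i → *-distribˡ-sum (χ σ) (crossTerm f σ i))))) ⟩
      sumWords m (λ σ → - (+ m * (χ σ * weight f σ)) + - sum (λ i → sum λ j → χ σ * crossTerm f σ i j))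
        ≡⟨ sumWords-distrib-+ m (λ σ → - (+ m * (χ σ * weight f σ))) (λ σ → - sum (λ i → sum λ j → χ σ * crossTerm f σ i j)) ⟩
      sumWords m (λ σ → - (+ m * (χ σ * weight f σ))) + sumWords m (λ σ → - sum (λ i → sum λ j → χ σ * crossTerm f σ i j))
        ≡⟨ cong₂ _+_ (trans (sumWords-neg m _) (cong -_ (sumWords-distribˡ-* m (+ m) _)))
                     (trans (sumWords-neg m _)
                          (cong -_ (trans (sumWords-sum₂ m (λ σ i j → χ σ * crossTerm f σ i j)) (sum-crossSum f f-inj)))) ⟩
      - (+ m * lifted f) + - 0ℤ
        ≡⟨ ℤP.+-identityʳ _ ⟩
      - (+ m * lifted f) ∎
      where
      open ≡-Reasoning
      Q : Vec (Fin m) m → Fin m → Fin k → ℤ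
      Q σ a c = product (λ l → columnDiff f l (transpose (old a) (new c) (old (lookup σ l))))
      ring : ∀ x M w s → x * - (M * w + s) ≡ - (M * (x * w)) + - (x * s)
      ring = solve-∀

    -- Transpositions of two new cells fix lifted f, those of two old cells act as on χ, and the m · k mixed ones
    -- contribute − m · lifted f.
    lifted-eigen : ∀ f → IsPerm f → adj lifted f ≡ (+ (k C 2) - + m + γ) * lifted f
    lifted-eigen f f-inj = begin
      adj lifted f
        ≡⟨ adj≡sumPairs lifted f ⟩
      sumPairs (λ a b → lifted (tmul a b f))
        ≡⟨ sumPairs-↑ {m} {k} (λ a b → lifted (tmul a b f)) ⟩
      (sumPairs (λ a b → lifted (tmul (old a) (old b) f)) + sum (λ a → sum λ c → lifted (tmul (old a) (new c) f)))
        + sumPairs (λ c c′ → lifted (tmul (new c) (new c′) f))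
        ≡⟨ cong₂ _+_ (cong₂ _+_ (old-old-block f) (old-new-block f f-inj)) (new-new-block f) ⟩
      (γ * lifted f + - (+ m * lifted f)) + + (k C 2) * lifted f
        ≡⟨ ring γ (+ m) (+ (k C 2)) (lifted f) ⟩
      (+ (k C 2) - + m + γ) * lifted f ∎
      where
      open ≡-Reasoning
      ring : ∀ g M t x → (g * x + - (M * x)) + t * x ≡ (t - M + g) * x
      ring = solve-∀

    col-transpose : ∀ {i j} → col i ≡ col j → ∀ l → col (transpose i j l) ≡ col l
    col-transpose {i} {j} same l = by-cases (l ≟ i) (l ≟ j)
      where
      by-cases : Dec (l ≡ i) → Dec (l ≡ j) → col (transpose i j l) ≡ col l
      by-cases (yes refl) _ = trans (cong col (transpose-matchˡ l j)) (sym same)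
      by-cases (no _) (yes refl) = trans (cong col (transpose-matchʳ i l)) same
      by-cases (no l≢i) (no l≢j) = cong col (transpose-mismatch l≢i l≢j)

    lifted-swap-old-old : ∀ f {i j} → i ≢ j → col i ≡ col j → lifted (swapAt (old i) (old j) f) ≡ - lifted f
    lifted-swap-old-old f {i} {j} i≢j same =
      trans (sumWords-cong m (λ σ → cong (χ σ *_) (weight-swap σ))) (sum-χ-swapAt i≢j same (weight f))
      where
      columnDiff-swap : ∀ l u → columnDiff (swapAt (old i) (old j) f) l u ≡ columnDiff f (transpose i j l) u
      columnDiff-swap l u = cong₂ (λ x y → δ x u - δ y u)
        (trans (lookup-swapAt (old i) (old j) f (old l)) (cong (lookup f) (transpose-old-old i j l)))
        (trans (lookup-swapAt (old i) (old j) f (new (col l)))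
               (cong (lookup f) (trans (transpose-mismatch new≢old new≢old) (cong new (sym (col-transpose same l))))))
      weight-swap : ∀ σ → weight (swapAt (old i) (old j) f) σ ≡ weight f (swapAt i j σ)
      weight-swap σ = begin
        product (λ l → columnDiff (swapAt (old i) (old j) f) l (old (lookup σ l)))
          ≡⟨ Product.sum-cong-≗ (λ l → trans (columnDiff-swap l _)
               (cong (λ x → columnDiff f (transpose i j l) (old (lookup σ x))) (sym (transpose-involutive i j l)))) ⟩
        product (λ l → columnDiff f (transpose i j l) (old (lookup σ (transpose i j (transpose i j l)))))
          ≡⟨ product-transpose i j (λ l → columnDiff f l (old (lookup σ (transpose i j l)))) ⟩
        product (λ l → columnDiff f l (old (lookup σ (transpose i j l))))
          ≡⟨ Product.sum-cong-≗ (λ l → cong (λ x → columnDiff f l (old x)) (sym (lookup-swapAt i j σ l))) ⟩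
        weight f (swapAt i j σ) ∎
        where open ≡-Reasoning

    -- Exchanging the entries of old i and of the new cell above it negates the factor of i; every other factor
    -- either is unchanged or changes by - columnDiff f i, and the telescoping terms of the latter kind cancel in
    -- pairs by the antisymmetry of χ.
    module SwapOldNew (f : Vec (Fin N) N) (i : Fin m) where

      c : Fin k
      c = col i

      f′ : Vec (Fin N) N
      f′ = swapAt (old i) (new c) f

      flipped : Fin m → Fin N → ℤ
      flipped l u = if does (l ≟ i) then - columnDiff f i u else columnDiff f l u

      lookup-old : ∀ l → lookup f′ (old l) ≡ (if does (l ≟ i) then lookup f (new c) else lookup f (old l))
      lookup-old l with l ≟ i
      ... | yes refl = trans (lookup-swapAt (old l) (new c) f (old l)) (cong (lookup f) (transpose-matchˡ (old l) (new c)))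
      ... | no l≢i = trans (lookup-swapAt (old i) (new c) f (old l))
                           (cong (lookup f) (transpose-mismatch (old-injective l≢i) (↑ˡ≢↑ʳ l c)))

      lookup-new : ∀ c′ → lookup f′ (new c′) ≡ (if does (c′ ≟ c) then lookup f (old i) else lookup f (new c′))
      lookup-new c′ with c′ ≟ c
      ... | yes refl = trans (lookup-swapAt (old i) (new c′) f (new c′)) (cong (lookup f) (transpose-matchʳ (old i) (new c′)))
      ... | no c′≢c = trans (lookup-swapAt (old i) (new c) f (new c′))
                            (cong (lookup f) (transpose-mismatch new≢old (new-injective c′≢c)))

      at-i : ∀ u → columnDiff f′ i u ≡ flipped i u
      at-i u rewrite lookup-old i | lookup-new c | dec-true (i ≟ i) refl | dec-true (c ≟ c) refl =
        ring (δ (lookup f (new c)) u) (δ (lookup f (old i)) u)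
        where
        ring : ∀ x y → x - y ≡ - (y - x)
        ring = solve-∀

      same-column : ∀ {l} → l ≢ i → col l ≡ c → ∀ u → columnDiff f′ l u - flipped l u ≡ - columnDiff f i u
      same-column {l} l≢i same u rewrite lookup-old l | lookup-new (col l) | dec-false (l ≟ i) l≢i | dec-true (col l ≟ c) same
        | same = ring (δ (lookup f (old l)) u) (δ (lookup f (old i)) u) (δ (lookup f (new c)) u)
        where
        ring : ∀ a b d → (a - b) - (a - d) ≡ - (b - d)
        ring = solve-∀

      other-column : ∀ {l} → l ≢ i → col l ≢ c → ∀ u → columnDiff f′ l u ≡ flipped l u
      other-column {l} l≢i cols≢ u rewrite lookup-old l | lookup-new (col l) | dec-false (l ≟ i) l≢i
        | dec-false (col l ≟ c) cols≢ = refl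

      flipped-i : ∀ u → flipped i u ≡ - columnDiff f i u
      flipped-i u rewrite dec-true (i ≟ i) refl = refl

      flippedFactor : Vec (Fin m) m → Fin m → ℤ
      flippedFactor σ l = flipped l (old (lookup σ l))

      product-flippedFactor : ∀ σ → product (flippedFactor σ) ≡ - weight f σ
      product-flippedFactor σ = begin
        product (flippedFactor σ)
          ≡⟨ product-pick (flippedFactor σ) i ⟩
        flippedFactor σ i * product (flippedFactor σ except i)
          ≡⟨ cong₂ _*_ (flipped-i _) (Product.sum-cong-≗ (except-cong i λ l l≢i → unflipped l l≢i)) ⟩
        - factor f σ i * product (factor f σ except i)
          ≡⟨ sym (ℤP.neg-distribˡ-* (factor f σ i) _) ⟩
        - (factor f σ i * product (factor f σ except i))
          ≡⟨ cong -_ (sym (product-pick (factor f σ) i)) ⟩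
        - weight f σ ∎
        where
        open ≡-Reasoning
        unflipped : ∀ l → l ≢ i → flippedFactor σ l ≡ factor f σ l
        unflipped l l≢i rewrite dec-false (l ≟ i) l≢i = refl

      row : Fin m → Fin m → Fin N → ℤ
      row l l′ u = hybrid (λ l″ → columnDiff f′ l″ u) (λ l″ → flipped l″ u) l l′

      telescope : Vec (Fin m) m → Fin m → ℤ
      telescope σ l = product (λ l′ → row l l′ (old (lookup σ l′)))

      row-diagonal : ∀ l u → row l l u ≡ columnDiff f′ l u - flipped l u
      row-diagonal l u rewrite <ᵇ-irrefl (toℕ l) | dec-true (l ≟ l) refl = refl

      row-i : ∀ {l} → l ≢ i → ∀ u → row l i u ≡ - columnDiff f i u
      row-i {l} l≢i u with toℕ i ℕ.<ᵇ toℕ l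
      ... | true = trans (at-i u) (flipped-i u)
      ... | false rewrite dec-false (i ≟ l) (l≢i ∘ sym) = flipped-i u

      row-transpose : ∀ {l} → l ≢ i → col l ≡ c → ∀ l′ u → row l (transpose i l l′) u ≡ row l l′ u
      row-transpose {l} l≢i same l′ u = by-cases (l′ ≟ i) (l′ ≟ l)
        where
        row-l : row l l u ≡ - columnDiff f i u
        row-l = trans (row-diagonal l u) (same-column l≢i same u)
        by-cases : Dec (l′ ≡ i) → Dec (l′ ≡ l) → row l (transpose i l l′) u ≡ row l l′ u
        by-cases (yes refl) _ = trans (cong (λ x → row l x u) (transpose-matchˡ l′ l)) (trans row-l (sym (row-i l≢i u)))
        by-cases (no _) (yes refl) = trans (cong (λ x → row l′ x u) (transpose-matchʳ i l′)) (trans (row-i l≢i u) (sym row-l))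
        by-cases (no l′≢i) (no l′≢l) = cong (λ x → row l x u) (transpose-mismatch l′≢i l′≢l)

      sum-telescope : ∀ l → sumWords m (λ σ → χ σ * telescope σ l) ≡ 0ℤ
      sum-telescope l = by-cases (l ≟ i) (col l ≟ c)
        where
        zero-at-l : (∀ u → columnDiff f′ l u - flipped l u ≡ 0ℤ) → sumWords m (λ σ → χ σ * telescope σ l) ≡ 0ℤ
        zero-at-l diff≡0 = sumWords-zero m λ σ → trans (cong (χ σ *_)
          (product-zero _ l (trans (row-diagonal l _) (diff≡0 _)))) (ℤP.*-zeroʳ (χ σ))
        by-cases : Dec (l ≡ i) → Dec (col l ≡ c) → sumWords m (λ σ → χ σ * telescope σ l) ≡ 0ℤ
        by-cases (yes refl) _ = zero-at-l λ u → trans (cong (_- flipped l u) (at-i u)) (ℤP.+-inverseʳ (flipped l u))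
        by-cases (no l≢i) (no cols≢) =
          zero-at-l λ u → trans (cong (_- flipped l u) (other-column l≢i cols≢ u)) (ℤP.+-inverseʳ (flipped l u))
        by-cases (no l≢i) (yes same) = sum-χ-invariant (l≢i ∘ sym) (sym same) (λ σ → telescope σ l) λ σ → begin
          product (λ l′ → row l l′ (old (lookup (swapAt i l σ) l′)))
            ≡⟨ Product.sum-cong-≗ (λ l′ → trans (cong (λ x → row l l′ (old x)) (lookup-swapAt i l σ l′))
                                                 (sym (row-transpose l≢i same l′ _))) ⟩
          product (λ l′ → row l (transpose i l l′) (old (lookup σ (transpose i l l′))))
            ≡⟨ product-transpose i l (λ l′ → row l l′ (old (lookup σ l′))) ⟩
          telescope σ l ∎
          where open ≡-Reasoning

      lifted-swap : lifted f′ ≡ - lifted f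
      lifted-swap = begin
        sumWords m (λ σ → χ σ * weight f′ σ)
          ≡⟨ sumWords-cong m (λ σ → cong (χ σ *_) (product-telescope (factor f′ σ) (flippedFactor σ))) ⟩
        sumWords m (λ σ → χ σ * (product (flippedFactor σ) + sum (telescope σ)))
          ≡⟨ sumWords-cong m (λ σ → trans (ℤP.*-distribˡ-+ (χ σ) _ _)
                                          (cong₂ _+_ (cong (χ σ *_) (product-flippedFactor σ)) (*-distribˡ-sum (χ σ) (telescope σ)))) ⟩
        sumWords m (λ σ → χ σ * - weight f σ + sum (λ l → χ σ * telescope σ l))
          ≡⟨ sumWords-distrib-+ m _ _ ⟩
        sumWords m (λ σ → χ σ * - weight f σ) + sumWords m (λ σ → sum (λ l → χ σ * telescope σ l))
          ≡⟨ cong₂ _+_ (trans (sumWords-cong m (λ σ → sym (ℤP.neg-distribʳ-* (χ σ) (weight f σ)))) (sumWords-neg m _))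
                       (trans (sumWords-sum m (λ σ l → χ σ * telescope σ l)) (sum-zero sum-telescope)) ⟩
        - lifted f + 0ℤ
          ≡⟨ ℤP.+-identityʳ _ ⟩
        - lifted f ∎
        where open ≡-Reasoning

    columnOf : Fin N → Fin k
    columnOf p = [ col , (λ c → c) ]′ (Fin.splitAt m p)

    columnOf-old : ∀ i → columnOf (old i) ≡ col i
    columnOf-old i = cong [ col , (λ c → c) ]′ (FinP.splitAt-↑ˡ m i k)

    columnOf-new : ∀ c → columnOf (new c) ≡ c
    columnOf-new c = cong [ col , (λ c → c) ]′ (FinP.splitAt-↑ʳ m k c)

    lifted-antisym : ∀ f {p q} → p ≢ q → columnOf p ≡ columnOf q → lifted (swapAt p q f) ≡ - lifted f
    lifted-antisym f {p} {q} p≢q same = by-cases (splitView m k p) (splitView m k q) p≢q same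
      where
      swap-old-new : ∀ i c → col i ≡ c → lifted (swapAt (old i) (new c) f) ≡ - lifted f
      swap-old-new i _ refl = SwapOldNew.lifted-swap f i
      by-cases : ∀ {p q} → SplitView m k p → SplitView m k q → p ≢ q → columnOf p ≡ columnOf q → lifted (swapAt p q f) ≡ - lifted f
      by-cases (inˡ i) (inˡ j) p≢q same =
        lifted-swap-old-old f (p≢q ∘ cong old) (trans (sym (columnOf-old i)) (trans same (columnOf-old j)))
      by-cases (inˡ i) (inʳ c) _ same = swap-old-new i c (trans (sym (columnOf-old i)) (trans same (columnOf-new c)))
      by-cases (inʳ c) (inˡ i) _ same = trans (cong lifted (swapAt-comm (new c) (old i) f))
        (swap-old-new i c (trans (sym (columnOf-old i)) (trans (sym same) (columnOf-new c))))
      by-cases (inʳ c) (inʳ c′) p≢q same = ⊥-elim (p≢q (cong new (trans (sym (columnOf-new c)) (trans same (columnOf-new c′)))))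

    lifted-idPerm : lifted idPerm ≡ χ idPerm
    lifted-idPerm = trans (sumWords-cong m (λ σ → trans (cong (χ σ *_) (Product.sum-cong-≗ (factor-idPerm σ))) (ℤP.*-comm (χ σ) _)))
      (sumWords-δ m idPerm χ)
      where
      δ-old : ∀ a b → δ (old a) (old b) ≡ δ a b
      δ-old a b with a ≟ b
      ... | yes refl = δ-refl (old a)
      ... | no a≢b = δ-≢ (old-injective a≢b)
      factor-idPerm : ∀ σ l → factor idPerm σ l ≡ δ (lookup idPerm l) (lookup σ l)
      factor-idPerm σ l = begin
        δ (lookup idPerm (old l)) (old (lookup σ l)) - δ (lookup idPerm (new (col l))) (old (lookup σ l))
          ≡⟨ cong₂ (λ x y → δ x (old (lookup σ l)) - δ y (old (lookup σ l)))
                   (VecP.lookup-allFin (old l)) (VecP.lookup-allFin (new (col l))) ⟩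
        δ (old l) (old (lookup σ l)) - δ (new (col l)) (old (lookup σ l))
          ≡⟨ cong₂ _-_ (δ-old l (lookup σ l)) (δ-≢ new≢old) ⟩
        δ l (lookup σ l) - 0ℤ
          ≡⟨ trans (ℤP.+-identityʳ _) (cong (λ x → δ x (lookup σ l)) (sym (VecP.lookup-allFin l))) ⟩
        δ (lookup idPerm l) (lookup σ l) ∎
        where open ≡-Reasoning

    -- lifted need not vanish off permutations, so it is cut down to them.
    restricted : Vec (Fin N) N → ℤ
    restricted f = if does (isPerm? f) then lifted f else 0ℤ

    restricted-perm : ∀ f → IsPerm f → restricted f ≡ lifted f
    restricted-perm f f-perm rewrite dec-true (isPerm? f) f-perm = refl

    restricted-not : ∀ f → ¬ IsPerm f → restricted f ≡ 0ℤ
    restricted-not f f-not rewrite dec-false (isPerm? f) f-not = refl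

    extended : ColumnEigenvector N k (+ (k C 2) - + m + γ)
    extended = record
      { vec = restricted
      ; column = columnOf
      ; eigen = λ f f-perm → begin
          adj restricted f
            ≡⟨ adj≡sumPairs restricted f ⟩
          sumPairs (λ a b → restricted (tmul a b f))
            ≡⟨ sumPairs-cong (λ a b → restricted-perm (tmul a b f) (IsPerm-tmul a b f f-perm)) ⟩
          sumPairs (λ a b → lifted (tmul a b f))
            ≡⟨ sym (adj≡sumPairs lifted f) ⟩
          adj lifted f
            ≡⟨ lifted-eigen f f-perm ⟩
          (+ (k C 2) - + m + γ) * lifted f
            ≡⟨ cong ((+ (k C 2) - + m + γ) *_) (sym (restricted-perm f f-perm)) ⟩
          (+ (k C 2) - + m + γ) * restricted f ∎
      ; antisym = antisym
      ; vanishes = restricted-not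
      ; nonzero = λ eq → nonzero (trans (sym (trans (restricted-perm idPerm IsPerm-idPerm) lifted-idPerm)) eq)
      }
      where
      open ≡-Reasoning
      antisym : ∀ f {p q} → p ≢ q → columnOf p ≡ columnOf q → restricted (swapAt p q f) ≡ - restricted f
      antisym f {p} {q} p≢q same with isPerm? f
      ... | yes f-perm = trans (restricted-perm (swapAt p q f) (IsPerm-swapAt p q f f-perm))
                               (trans (lifted-antisym f {p} {q} p≢q same) (cong -_ (sym (restricted-perm f f-perm))))
      ... | no f-not = trans (restricted-not (swapAt p q f) (f-not ∘ IsPerm-swapAt⁻ p q f)) (cong -_ (sym (restricted-not f f-not)))

  emptyDiagram : ColumnEigenvector 0 0 0ℤ
  emptyDiagram = record
    { vec = λ _ → 1ℤ ; column = λ () ; eigen = λ _ _ → refl ; antisym = λ { _ {()} }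
    ; vanishes = λ { [] not → ⊥-elim (not (λ ())) } ; nonzero = λ () }

  -- Content sums

  -- Rows are listed from the top; adding r after the rows below matches the cell numbering Fin (m + k) of AddRow.
  cells : List ℕ → ℕ
  cells [] = 0
  cells (r ∷ rs) = cells rs ℕ.+ r

  width : List ℕ → ℕ
  width [] = 0
  width (r ∷ _) = r

  -- The sum of the contents (column − row) of the cells: a top row of length r contributes 0 + 1 + ⋯ + (r − 1)
  -- and moves every cell below it one row down.
  contentSum : List ℕ → ℤ
  contentSum [] = 0ℤ
  contentSum (r ∷ rs) = + (r C 2) - + cells rs + contentSum rs

  youngEigenvector : ∀ rs → Linked ℕ._≥_ rs → ColumnEigenvector (cells rs) (width rs) (contentSum rs)
  youngEigenvector [] [] = emptyDiagram
  youngEigenvector (r ∷ []) [-] = AddRow.extended (widen ℕ.z≤n emptyDiagram)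
  youngEigenvector (r ∷ s ∷ rs) (r≥s ∷ linked) = AddRow.extended (widen r≥s (youngEigenvector (s ∷ rs) linked))

  contentSum-isEigenvalue : ∀ rs → Linked ℕ._≥_ rs → IsCayTEigenvalue (cells rs) (contentSum rs)
  contentSum-isEigenvalue rs linked = vec , eigen , idPerm , IsPerm-idPerm , nonzero
    where open ColumnEigenvector (youngEigenvector rs linked)

  C2-twice : ∀ r → + 2 * + (r C 2) ≡ + r * + r - + r
  C2-twice zero = refl
  C2-twice (suc r) = begin
    + 2 * + (suc r C 2)            ≡⟨ cong (λ x → + 2 * + x) (suc-C2 r) ⟩
    + 2 * (+ r + + (r C 2))        ≡⟨ ℤP.*-distribˡ-+ (+ 2) (+ r) (+ (r C 2)) ⟩
    + 2 * + r + + 2 * + (r C 2)    ≡⟨ cong (_+_ (+ 2 * + r)) (C2-twice r) ⟩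
    + 2 * + r + (+ r * + r - + r)  ≡⟨ ring (+ r) ⟩
    (1ℤ + + r) * (1ℤ + + r) - (1ℤ + + r) ∎
    where
    open ≡-Reasoning
    ring : ∀ x → + 2 * x + (x * x - x) ≡ (1ℤ + x) * (1ℤ + x) - (1ℤ + x)
    ring = solve-∀

  contentSum-∷-twice : ∀ r rs → + 2 * contentSum (r ∷ rs) ≡ (+ r * + r - + r) - + 2 * + cells rs + + 2 * contentSum rs
  contentSum-∷-twice r rs = begin
    + 2 * (+ (r C 2) - + cells rs + contentSum rs)
      ≡⟨ ring (+ (r C 2)) (+ cells rs) (contentSum rs) ⟩
    + 2 * + (r C 2) - + 2 * + cells rs + + 2 * contentSum rs
      ≡⟨ cong (λ t → t - + 2 * + cells rs + + 2 * contentSum rs) (C2-twice r) ⟩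
    (+ r * + r - + r) - + 2 * + cells rs + + 2 * contentSum rs ∎
    where
    open ≡-Reasoning
    ring : ∀ t s c → + 2 * (t - s + c) ≡ + 2 * t - + 2 * s + + 2 * c
    ring = solve-∀

  cells-++ : ∀ xs ys → cells (xs List.++ ys) ≡ cells xs ℕ.+ cells ys
  cells-++ [] ys = refl
  cells-++ (x ∷ xs) ys = trans (cong (ℕ._+ x) (cells-++ xs ys)) (ring (cells xs) (cells ys) x)
    where
    ring : ∀ a b x → a ℕ.+ b ℕ.+ x ≡ a ℕ.+ x ℕ.+ b
    ring = ℕSolver.solve-∀

  contentSum-++ : ∀ xs ys → contentSum (xs List.++ ys) ≡ contentSum xs + contentSum ys - + List.length xs * + cells ys
  contentSum-++ [] ys = solve-∀′ (contentSum ys) (+ cells ys)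
    where
    solve-∀′ : ∀ c s → c ≡ 0ℤ + c - 0ℤ * s
    solve-∀′ = solve-∀
  contentSum-++ (x ∷ xs) ys = begin
    + (x C 2) - + cells (xs List.++ ys) + contentSum (xs List.++ ys)
      ≡⟨ cong₂ (λ s c → + (x C 2) - s + c) (trans (cong +_ (cells-++ xs ys)) (ℤP.pos-+ (cells xs) (cells ys))) (contentSum-++ xs ys) ⟩
    + (x C 2) - (+ cells xs + + cells ys) + (contentSum xs + contentSum ys - + List.length xs * + cells ys)
      ≡⟨ ring (+ (x C 2)) (+ cells xs) (+ cells ys) (contentSum xs) (contentSum ys) (+ List.length xs) ⟩
    (+ (x C 2) - + cells xs + contentSum xs) + contentSum ys - (1ℤ + + List.length xs) * + cells ys ∎
    where
    open ≡-Reasoning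
    ring : ∀ t a b c d l → t - (a + b) + (c + d - l * b) ≡ (t - a + c) + d - (1ℤ + l) * b
    ring = solve-∀

  module _ (x : ℕ) where

    cells-replicate : ∀ u → cells (List.replicate u x) ≡ u ℕ.* x
    cells-replicate zero = refl
    cells-replicate (suc u) = trans (cong (ℕ._+ x) (cells-replicate u)) (ℕP.+-comm (u ℕ.* x) x)

    contentSum-replicate : ∀ u → + 2 * contentSum (List.replicate u x) ≡ + u * (+ x * + x - + x) - + x * (+ u * + u - + u)
    contentSum-replicate zero = ring (+ x)
      where
      ring : ∀ x → 0ℤ ≡ 0ℤ * (x * x - x) - x * (0ℤ * 0ℤ - 0ℤ)
      ring = solve-∀
    contentSum-replicate (suc u) = begin
      + 2 * contentSum (x ∷ List.replicate u x)
        ≡⟨ contentSum-∷-twice x (List.replicate u x) ⟩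
      (+ x * + x - + x) - + 2 * + cells (List.replicate u x) + + 2 * contentSum (List.replicate u x)
        ≡⟨ cong₂ (λ s c → (+ x * + x - + x) - + 2 * s + c) (trans (cong +_ (cells-replicate u)) (ℤP.pos-* u x)) (contentSum-replicate u) ⟩
      (+ x * + x - + x) - + 2 * (+ u * + x) + (+ u * (+ x * + x - + x) - + x * (+ u * + u - + u))
        ≡⟨ ring (+ u) (+ x) ⟩
      (1ℤ + + u) * (+ x * + x - + x) - + x * ((1ℤ + + u) * (1ℤ + + u) - (1ℤ + + u)) ∎
      where
      open ≡-Reasoning
      ring : ∀ u x → (x * x - x) - + 2 * (u * x) + (u * (x * x - x) - x * (u * u - u))
                     ≡ (1ℤ + u) * (x * x - x) - x * ((1ℤ + u) * (1ℤ + u) - (1ℤ + u))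
      ring = solve-∀

  -- The partitions used for the corollary

  cong₃ : ∀ {A B C D : Set} (f : A → B → C → D) {a a′ b b′ c c′} → a ≡ a′ → b ≡ b′ → c ≡ c′ → f a b c ≡ f a′ b′ c′
  cong₃ f refl refl refl = refl

  middle : ℕ → List ℕ
  middle zero = []
  middle (suc j) = (j ℕ.+ 3) ∷ List.replicate j 2

  length-middle : ∀ j → List.length (middle j) ≡ j
  length-middle zero = refl
  length-middle (suc j) = cong suc (ListP.length-replicate j)

  cells-middle : ∀ j → cells (middle j) ≡ 3 ℕ.* j
  cells-middle zero = refl
  cells-middle (suc j) = trans (cong (ℕ._+ (j ℕ.+ 3)) (cells-replicate 2 j)) (ring j)
    where
    ring : ∀ j → j ℕ.* 2 ℕ.+ (j ℕ.+ 3) ≡ 3 ℕ.* suc j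
    ring = ℕSolver.solve-∀

  contentSum-middle : ∀ j → + 2 * contentSum (middle j) ≡ + 7 * + j - + j * + j
  contentSum-middle zero = refl
  contentSum-middle (suc j) = begin
    + 2 * contentSum ((j ℕ.+ 3) ∷ List.replicate j 2)
      ≡⟨ contentSum-∷-twice (j ℕ.+ 3) (List.replicate j 2) ⟩
    (+ (j ℕ.+ 3) * + (j ℕ.+ 3) - + (j ℕ.+ 3)) - + 2 * + cells (List.replicate j 2) + + 2 * contentSum (List.replicate j 2)
      ≡⟨ cong₃ (λ r s c → (r * r - r) - + 2 * s + c) (ℤP.pos-+ j 3) (trans (cong +_ (cells-replicate 2 j)) (ℤP.pos-* j 2))
               (contentSum-replicate 2 j) ⟩
    ((+ j + + 3) * (+ j + + 3) - (+ j + + 3)) - + 2 * (+ j * + 2) + (+ j * (+ 2 * + 2 - + 2) - + 2 * (+ j * + j - + j))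
      ≡⟨ ring (+ j) ⟩
    + 7 * (1ℤ + + j) - (1ℤ + + j) * (1ℤ + + j) ∎
    where
    open ≡-Reasoning
    ring : ∀ j → ((j + + 3) * (j + + 3) - (j + + 3)) - + 2 * (j * + 2) + (j * (+ 2 * + 2 - + 2) - + 2 * (j * j - j))
                 ≡ + 7 * (1ℤ + j) - (1ℤ + j) * (1ℤ + j)
    ring = solve-∀

  shape : ℕ → ℕ → ℕ → List ℕ
  shape j d e = (3 ℕ.+ j ℕ.+ d ℕ.+ e) ∷ (3 ℕ.+ j ℕ.+ d) ∷ (middle j List.++ List.replicate (1 ℕ.+ d ℕ.+ e) 1)

  cells-lower : ∀ j s → cells (middle j List.++ List.replicate s 1) ≡ 3 ℕ.* j ℕ.+ s
  cells-lower j s = trans (cells-++ (middle j) (List.replicate s 1))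
    (cong₂ ℕ._+_ (cells-middle j) (trans (cells-replicate 1 s) (ℕP.*-identityʳ s)))

  contentSum-lower : ∀ j s → + 2 * contentSum (middle j List.++ List.replicate s 1)
                             ≡ (+ 7 * + j - + j * + j) - (+ s * + s - + s) - + 2 * (+ j * + s)
  contentSum-lower j s = begin
    + 2 * contentSum (middle j List.++ List.replicate s 1)
      ≡⟨ cong (+ 2 *_) (contentSum-++ (middle j) (List.replicate s 1)) ⟩
    + 2 * (contentSum (middle j) + contentSum (List.replicate s 1) - + List.length (middle j) * + cells (List.replicate s 1))
      ≡⟨ ring₁ (contentSum (middle j)) (contentSum (List.replicate s 1)) (+ List.length (middle j) * + cells (List.replicate s 1)) ⟩
    + 2 * contentSum (middle j) + + 2 * contentSum (List.replicate s 1) - + 2 * (+ List.length (middle j) * + cells (List.replicate s 1))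
      ≡⟨ cong₃ (λ x y z → x + y - + 2 * z) (contentSum-middle j) (contentSum-replicate 1 s)
               (cong₂ (λ l c → + l * + c) (length-middle j) (trans (cells-replicate 1 s) (ℕP.*-identityʳ s))) ⟩
    (+ 7 * + j - + j * + j) + (+ s * (1ℤ * 1ℤ - 1ℤ) - 1ℤ * (+ s * + s - + s)) - + 2 * (+ j * + s)
      ≡⟨ ring₂ (+ 7 * + j - + j * + j) (+ s) (+ 2 * (+ j * + s)) ⟩
    (+ 7 * + j - + j * + j) - (+ s * + s - + s) - + 2 * (+ j * + s) ∎
    where
    open ≡-Reasoning
    ring₁ : ∀ x y z → + 2 * (x + y - z) ≡ + 2 * x + + 2 * y - + 2 * z
    ring₁ = solve-∀
    ring₂ : ∀ x s z → x + (s * (1ℤ * 1ℤ - 1ℤ) - 1ℤ * (s * s - s)) - z ≡ x - (s * s - s) - z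
    ring₂ = solve-∀

  cells-shape : ∀ j d e → cells (shape j d e) ≡ 7 ℕ.+ 5 ℕ.* j ℕ.+ 3 ℕ.* d ℕ.+ 2 ℕ.* e
  cells-shape j d e = trans (cong (λ c → c ℕ.+ (3 ℕ.+ j ℕ.+ d) ℕ.+ (3 ℕ.+ j ℕ.+ d ℕ.+ e)) (cells-lower j (1 ℕ.+ d ℕ.+ e)))
    (ring j d e)
    where
    ring : ∀ j d e → 3 ℕ.* j ℕ.+ (1 ℕ.+ d ℕ.+ e) ℕ.+ (3 ℕ.+ j ℕ.+ d) ℕ.+ (3 ℕ.+ j ℕ.+ d ℕ.+ e) ≡ 7 ℕ.+ 5 ℕ.* j ℕ.+ 3 ℕ.* d ℕ.+ 2 ℕ.* e
    ring = ℕSolver.solve-∀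

  contentSum-shape : ∀ j d e → contentSum (shape j d e) + + j ≡ + ((2 ℕ.+ j ℕ.+ d) C 2)
  contentSum-shape j d e = ℤP.*-cancelˡ-≡ (+ 2) _ _ (begin
    + 2 * (contentSum (r₀ ∷ r₁ ∷ lower) + + j)
      ≡⟨ ℤP.*-distribˡ-+ (+ 2) (contentSum (r₀ ∷ r₁ ∷ lower)) (+ j) ⟩
    + 2 * contentSum (r₀ ∷ r₁ ∷ lower) + + 2 * + j
      ≡⟨ cong (_+ + 2 * + j) (trans (contentSum-∷-twice r₀ (r₁ ∷ lower))
                                    (cong (λ c → (+ r₀ * + r₀ - + r₀) - + 2 * + cells (r₁ ∷ lower) + c) (contentSum-∷-twice r₁ lower))) ⟩
    ((+ r₀ * + r₀ - + r₀) - + 2 * (+ cells lower + + r₁)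
      + ((+ r₁ * + r₁ - + r₁) - + 2 * + cells lower + + 2 * contentSum lower)) + + 2 * + j
      ≡⟨ cong₂ (λ c t → ((+ r₀ * + r₀ - + r₀) - + 2 * (c + + r₁) + ((+ r₁ * + r₁ - + r₁) - + 2 * c + t)) + + 2 * + j)
               (trans (cong +_ (cells-lower j s)) (cong (_+ + s) (ℤP.pos-* 3 j))) (contentSum-lower j s) ⟩
    ((+ r₀ * + r₀ - + r₀) - + 2 * ((+ 3 * + j + + s) + + r₁)
      + ((+ r₁ * + r₁ - + r₁) - + 2 * (+ 3 * + j + + s) + ((+ 7 * + j - + j * + j) - (+ s * + s - + s) - + 2 * (+ j * + s))))
      + + 2 * + j
      ≡⟨ ring (+ j) (+ d) (+ e) ⟩
    + a * + a - + a
      ≡⟨ sym (C2-twice a) ⟩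
    + 2 * + (a C 2) ∎)
    where
    open ≡-Reasoning
    r₀ r₁ s a : ℕ
    r₀ = 3 ℕ.+ j ℕ.+ d ℕ.+ e
    r₁ = 3 ℕ.+ j ℕ.+ d
    s = 1 ℕ.+ d ℕ.+ e
    a = 2 ℕ.+ j ℕ.+ d
    lower : List ℕ
    lower = middle j List.++ List.replicate s 1
    ring : ∀ j d e → let r₀ = + 3 + j + d + e; r₁ = + 3 + j + d; s = 1ℤ + d + e; t = + 3 * j + s in
           ((r₀ * r₀ - r₀) - + 2 * (t + r₁) + ((r₁ * r₁ - r₁) - + 2 * t + ((+ 7 * j - j * j) - (s * s - s) - + 2 * (j * s)))) + + 2 * j
           ≡ (+ 2 + j + d) * (+ 2 + j + d) - (+ 2 + j + d)
    ring = solve-∀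

  linked-∷ : ∀ {x xs} → width xs ℕ.≤ x → Linked ℕ._≥_ xs → Linked ℕ._≥_ (x ∷ xs)
  linked-∷ _ [] = [-]
  linked-∷ x≥ [-] = x≥ ∷ [-]
  linked-∷ x≥ (y≥ ∷ linked) = x≥ ∷ y≥ ∷ linked

  width-replicate-++ : ∀ u {x} xs → width xs ℕ.≤ x → width (List.replicate u x List.++ xs) ℕ.≤ x
  width-replicate-++ zero xs x≥ = x≥
  width-replicate-++ (suc u) xs x≥ = ℕP.≤-refl

  linked-replicate-++ : ∀ u {x} xs → width xs ℕ.≤ x → Linked ℕ._≥_ xs → Linked ℕ._≥_ (List.replicate u x List.++ xs)
  linked-replicate-++ zero xs x≥ linked = linked
  linked-replicate-++ (suc u) xs x≥ linked = linked-∷ (width-replicate-++ u xs x≥) (linked-replicate-++ u xs x≥ linked)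

  linked-replicate : ∀ u x → Linked ℕ._≥_ (List.replicate u x)
  linked-replicate u x = subst (Linked ℕ._≥_) (ListP.++-identityʳ (List.replicate u x)) (linked-replicate-++ u [] ℕ.z≤n [])

  width-replicate : ∀ u x → width (List.replicate u x) ℕ.≤ x
  width-replicate u x = subst (λ xs → width xs ℕ.≤ x) (ListP.++-identityʳ (List.replicate u x)) (width-replicate-++ u [] ℕ.z≤n)

  width-lower : ∀ j s → width (middle j List.++ List.replicate s 1) ℕ.≤ 2 ℕ.+ j
  width-lower zero s = ℕP.≤-trans (width-replicate s 1) (ℕ.s≤s ℕ.z≤n)
  width-lower (suc j) s = ℕP.≤-reflexive (ℕP.+-comm j 3)

  linked-lower : ∀ j s → Linked ℕ._≥_ (middle j List.++ List.replicate s 1)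
  linked-lower zero s = linked-replicate s 1
  linked-lower (suc j) s = linked-∷ (ℕP.≤-trans (width-replicate-++ j _ ones≤2) (ℕP.≤-trans (ℕP.n≤1+n 2) (ℕP.m≤n+m 3 j)))
                                    (linked-replicate-++ j _ ones≤2 (linked-replicate s 1))
    where
    ones≤2 : width (List.replicate s 1) ℕ.≤ 2
    ones≤2 = ℕP.≤-trans (width-replicate s 1) (ℕ.s≤s ℕ.z≤n)

  linked-shape : ∀ j d e → Linked ℕ._≥_ (shape j d e)
  linked-shape j d e = ℕP.m≤m+n (3 ℕ.+ j ℕ.+ d) e
    ∷ linked-∷ (ℕP.≤-trans (width-lower j (1 ℕ.+ d ℕ.+ e)) (ℕP.≤-trans (ℕP.n≤1+n (2 ℕ.+ j)) (ℕP.m≤m+n (3 ℕ.+ j) d)))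
               (linked-lower j (1 ℕ.+ d ℕ.+ e))

  shape-eigenvalue : ∀ j d e k → k ℕ.+ j ≡ (2 ℕ.+ j ℕ.+ d) C 2 →
                     IsCayTEigenvalue (7 ℕ.+ 5 ℕ.* j ℕ.+ 3 ℕ.* d ℕ.+ 2 ℕ.* e) (+ k)
  shape-eigenvalue j d e k k+j≡ = subst₂ IsCayTEigenvalue (cells-shape j d e) contentSum≡k
    (contentSum-isEigenvalue (shape j d e) (linked-shape j d e))
    where
    contentSum≡k : contentSum (shape j d e) ≡ + k
    contentSum≡k = ∙-cancelʳ (+ j) _ _ (trans (contentSum-shape j d e) (cong +_ (sym k+j≡)))

  C2-window : ∀ a k → (a ℕ.∸ 1) C 2 ℕ.+ 1 ℕ.≤ k → k ℕ.≤ a C 2 → ∃ λ j → ∃ λ d → a ≡ 2 ℕ.+ j ℕ.+ d × k ℕ.+ j ≡ a C 2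
  C2-window zero k lo hi with () ← ℕP.≤-trans lo hi
  C2-window (suc zero) k lo hi with () ← ℕP.≤-trans lo hi
  C2-window (suc (suc b)) k lo hi = j , b ℕ.∸ j , a≡ , ℕP.m+[n∸m]≡n hi
    where
    j : ℕ
    j = suc (suc b) C 2 ℕ.∸ k
    j≤b : j ℕ.≤ b
    j≤b = ℕP.+-cancelʳ-≤ (suc b C 2 ℕ.+ 1) j b (begin
      j ℕ.+ (suc b C 2 ℕ.+ 1)  ≡⟨ ℕP.+-comm j _ ⟩
      suc b C 2 ℕ.+ 1 ℕ.+ j    ≤⟨ ℕP.+-monoˡ-≤ j lo ⟩
      k ℕ.+ j                  ≡⟨ ℕP.m+[n∸m]≡n hi ⟩
      suc (suc b) C 2          ≡⟨ suc-C2 (suc b) ⟩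
      suc b ℕ.+ suc b C 2      ≡⟨ ring b (suc b C 2) ⟩
      b ℕ.+ (suc b C 2 ℕ.+ 1)  ∎)
      where
      open ℕP.≤-Reasoning
      ring : ∀ b c → suc b ℕ.+ c ≡ b ℕ.+ (c ℕ.+ 1)
      ring = ℕSolver.solve-∀
    a≡ : suc (suc b) ≡ 2 ℕ.+ j ℕ.+ (b ℕ.∸ j)
    a≡ = cong (2 ℕ.+_) (trans (sym (ℕP.m+[n∸m]≡n j≤b)) (sym (ℕP.+-assoc 0 j (b ℕ.∸ j))))

  odd-difference : ∀ n a → (n ℕ.∸ a) % 2 ≡ 1 → n ≡ a ℕ.+ suc ((n ℕ.∸ a) / 2 ℕ.* 2)
  odd-difference n a odd with a ℕ.≤? n
  ... | yes a≤n = trans (sym (ℕP.m+[n∸m]≡n a≤n))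
                        (cong (a ℕ.+_) (trans (m≡m%n+[m/n]*n (n ℕ.∸ a) 2) (cong (ℕ._+ (n ℕ.∸ a) / 2 ℕ.* 2) odd)))
  ... | no a≰n with () ← trans (sym (cong (ℕ._% 2) (ℕP.m≤n⇒m∸n≡0 (ℕP.<⇒≤ (ℕP.≰⇒> a≰n))))) odd

  m≤n/o⇒m*o≤n : ∀ {m} n o .{{_ : ℕ.NonZero o}} → m ℕ.≤ n / o → m ℕ.* o ℕ.≤ n
  m≤n/o⇒m*o≤n n o m≤n/o = ℕP.≤-trans (ℕP.*-monoˡ-≤ o m≤n/o) (m/n*n≤m n o)

  size-decomposition : ∀ n j d → 2 ℕ.+ j ℕ.+ d ℕ.≤ (n ℕ.+ 3) / 5 → (n ℕ.∸ (2 ℕ.+ j ℕ.+ d)) % 2 ≡ 1 →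
                       ∃ λ e → n ≡ 7 ℕ.+ 5 ℕ.* j ℕ.+ 3 ℕ.* d ℕ.+ 2 ℕ.* e
  size-decomposition n j d a≤ odd = t ℕ.∸ u , (begin
    n                                                    ≡⟨ odd-difference n a odd ⟩
    a ℕ.+ suc (t ℕ.* 2)                                  ≡⟨ cong (λ x → a ℕ.+ suc (x ℕ.* 2)) (sym (ℕP.m+[n∸m]≡n u≤t)) ⟩
    a ℕ.+ suc ((u ℕ.+ (t ℕ.∸ u)) ℕ.* 2)                  ≡⟨ ring₃ j d (t ℕ.∸ u) ⟩
    7 ℕ.+ 5 ℕ.* j ℕ.+ 3 ℕ.* d ℕ.+ 2 ℕ.* (t ℕ.∸ u)        ∎)
    where
    open ≡-Reasoning
    a t u : ℕ
    a = 2 ℕ.+ j ℕ.+ d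
    t = (n ℕ.∸ a) / 2
    u = 2 ℕ.+ 2 ℕ.* j ℕ.+ d
    ring₁ : ∀ j d → (2 ℕ.+ j ℕ.+ d) ℕ.* 5 ≡ (6 ℕ.+ j ℕ.+ d) ℕ.+ (2 ℕ.+ 2 ℕ.* j ℕ.+ 2 ℕ.* d) ℕ.* 2
    ring₁ = ℕSolver.solve-∀
    ring₂ : ∀ j d t → (2 ℕ.+ j ℕ.+ d) ℕ.+ suc (t ℕ.* 2) ℕ.+ 3 ≡ (6 ℕ.+ j ℕ.+ d) ℕ.+ t ℕ.* 2
    ring₂ = ℕSolver.solve-∀
    ring₃ : ∀ j d e → (2 ℕ.+ j ℕ.+ d) ℕ.+ suc ((2 ℕ.+ 2 ℕ.* j ℕ.+ d ℕ.+ e) ℕ.* 2) ≡ 7 ℕ.+ 5 ℕ.* j ℕ.+ 3 ℕ.* d ℕ.+ 2 ℕ.* e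
    ring₃ = ℕSolver.solve-∀
    a*5≤ : a ℕ.* 5 ℕ.≤ a ℕ.+ suc (t ℕ.* 2) ℕ.+ 3
    a*5≤ = subst (λ x → a ℕ.* 5 ℕ.≤ x ℕ.+ 3) (odd-difference n a odd) (m≤n/o⇒m*o≤n (n ℕ.+ 3) 5 a≤)
    -- 5a ≤ n + 3 = a + 4 + 2t gives 2a − 2 ≤ t.
    u≤t : u ℕ.≤ t
    u≤t = ℕP.≤-trans (ℕP.+-monoʳ-≤ (2 ℕ.+ 2 ℕ.* j) (ℕP.m≤m+n d (d ℕ.+ 0)))
            (ℕP.*-cancelʳ-≤ _ t 2 (ℕP.+-cancelˡ-≤ (6 ℕ.+ j ℕ.+ d) _ _ (subst₂ ℕ._≤_ (ring₁ j d) (ring₂ j d t) a*5≤)))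

open import Data.Nat using (ℕ; _≤_; _+_; _∸_; _/_; _%_)
open import Data.Nat.Combinatorics using (_C_)
open import Data.Integer using (+_)
open import Relation.Binary.PropositionalEquality using (_≡_; refl)
open import Data.Product using (_,_)
open PartitionEigenvalues using (C2-window; size-decomposition; shape-eigenvalue)

corollary3p1 : (n : ℕ) → 17 ≤ n → (a : ℕ) → 3 ≤ a → a ≤ (n + 3) / 5 →
    (n ∸ a) % 2 ≡ 1 → (k : ℕ) → ((a ∸ 1) C 2) + 1 ≤ k → k ≤ a C 2 →
    IsCayTEigenvalue n (+ k)
corollary3p1 n _ a _ a≤ odd k lo hi with C2-window a k lo hi
... | j , d , refl , k+j≡ with size-decomposition n j d a≤ odd
... | e , refl = shape-eigenvalue j d e k k+j≡
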